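{- Let $q$ be a prime power, $n\ge1$ an integer, and $H(x)\in\mathbb{F}_{q^n}[x]$. Let $P_H=\{\gamma\in\mathbb{F}_{q^n} : x+\gamma\,\mathrm{Tr}(H(x)) \text{ is a permutation polynomial over } \mathbb{F}_{q^n}\}$. Assume that $\mathrm{Tr}(H(x))$ is not a constant map on $\mathbb{F}_{q^n}$. Then $|P_H|\le q^n-q^{n-1}$. Equality holds if and only if $\mathrm{Tr}(H(x))$ is an $\mathbb{F}_q$-linear function of $x\in\mathbb{F}_{q^n}$, which means that there exists an element $u\in\mathbb{F}_{q^n}$ such that $\mathrm{Tr}(H(x))=\mathrm{Tr}(ux)$ for all $x\in\mathbb{F}_{q^n}$.
   Context: $\mathrm{Tr}:\mathbb{F}_{q^n}\to\mathbb{F}_q$ is the trace map $\mathrm{Tr}(x)=x+x^q+\cdots+x^{q^{n-1}}$. A polynomial $f$ over $\mathbb{F}_{q^n}$ is a permutation polynomial if the map $x\mapsto f(x)$ is a bijection of $\mathbb{F}_{q^n}$ onto itself. $|A|$ denotes the cardinality of a set $A$.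
   Formalization: "Equality implies linear" fails as printed (q=2, n=1, H=x+1); proved instead: equality holds iff Tr(H(x))−Tr(H(0)) is F_q-linear, hence the printed equivalence when Tr(H(0))=0; the bound and "linear iff Tr(ux)" are as stated. -}

module Defs where

open import Algebra.Apartness.Bundles using (HeytingField; HeytingCommutativeRing)
open import Algebra.Bundles using (CommutativeRing)
open import Data.Fin.Base using (Fin; toℕ)
open import Data.Fin.Properties using (all?; any?) renaming (_≟_ to _≟ᶠ_)
open import Data.List.Base using (List; []; _∷_; length; filter; tabulate)
open import Data.Nat.Base using (ℕ; _≤_; _^_)
open import Data.Nat.Primality using (Prime)
open import Data.Product.Base using (∃; ∃₂; _×_; _,_)
open import Function.Bundles using (Inverse)
open import Function.Definitions using (Congruent; Injective; Surjective; Bijective)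
open import Level using (_⊔_)
open import Relation.Binary.PropositionalEquality as ≡ using (_≡_)
open import Relation.Nullary.Decidable.Core using (Dec; map′; _×-dec_; _→-dec_)
open import Relation.Unary using (Pred; Decidable)

import Algebra.Properties.CommutativeMonoid.Sum as Sum
import Algebra.Properties.Semiring.Exp as Exp

IsPrimePower : ℕ → Set
IsPrimePower q = ∃₂ λ p k → Prime p × 1 ≤ k × q ≡ p ^ k

-- The library's HeytingField is a field whose apartness x # y amounts to
-- invertibility of x - y.  On a finite carrier this is classical: equality is
-- decidable, and x # y is equivalent to ¬ (x ≈ y).
ring : ∀ {c ℓ₁ ℓ₂} → HeytingField c ℓ₁ ℓ₂ → CommutativeRing c ℓ₁
ring K = HeytingCommutativeRing.commutativeRing (HeytingField.heytingCommutativeRing K)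

HasSize : ∀ {c ℓ₁ ℓ₂} → HeytingField c ℓ₁ ℓ₂ → ℕ → Set (c ⊔ ℓ₁)
HasSize K N = Inverse (CommutativeRing.setoid (ring K)) (≡.setoid (Fin N))

-- A field with q ^ n elements is a model of F_{q^n}.
module FiniteField
  {c ℓ₁ ℓ₂} (q n : ℕ) (K : HeytingField c ℓ₁ ℓ₂) (enum : HasSize K (q ^ n))
  where

  open CommutativeRing (ring K) public
  open Exp semiring public using () renaming (_^_ to _^ᴷ_)
  open Exp semiring using (^-congˡ)
  open Sum +-commutativeMonoid using (sum-syntax; sum-cong-≋)
  open Inverse enum using (to; from; to-cong; strictlyInverseʳ)

  Tr : Carrier → Carrier
  Tr x = ∑[ i < n ] (x ^ᴷ (q ^ toℕ i))

  -- F_q as the subfield of F_{q^n} fixed by x ↦ x ^ q.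
  InFq : Pred Carrier ℓ₁
  InFq x = x ^ᴷ q ≈ x

  IsFqLinear : (Carrier → Carrier) → Set (c ⊔ ℓ₁)
  IsFqLinear f =
      (∀ x y → f (x + y) ≈ f x + f y)
    × (∀ a x → InFq a → f (a * x) ≈ a * f x)

  -- Replacing f by f + b turns x + γ f(x) into its translate by γ b, so the set
  -- of γ for which it is a permutation sees f only up to an additive constant.
  IsFqAffine : (Carrier → Carrier) → Set (c ⊔ ℓ₁)
  IsFqAffine f = IsFqLinear (λ x → f x - f 0#)

  IsConstant : (Carrier → Carrier) → Set (c ⊔ ℓ₁)
  IsConstant f = ∃ λ a → ∀ x → f x ≈ a

  -- Coefficient lists, constant term first.
  Polynomial : Set c
  Polynomial = List Carrier

  eval : Polynomial → Carrier → Carrier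
  eval []       x = 0#
  eval (a ∷ as) x = a + x * eval as x

  TrOf : Polynomial → Carrier → Carrier
  TrOf H x = Tr (eval H x)

  IsPermutation : (Carrier → Carrier) → Set (c ⊔ ℓ₁)
  IsPermutation f = Bijective _≈_ _≈_ f

  -- A polynomial is a permutation polynomial exactly when the map it induces is
  -- a permutation, so x + γ Tr(H(x)) enters only through its map.
  P : Polynomial → Pred Carrier (c ⊔ ℓ₁)
  P H γ = IsPermutation (λ x → x + γ * TrOf H x)

  infix 4 _≟_
  _≟_ : ∀ x y → Dec (x ≈ y)
  x ≟ y = map′
    (λ e → trans (sym (strictlyInverseʳ x))
                 (trans (reflexive (≡.cong from e)) (strictlyInverseʳ y)))
    to-cong
    (to x ≟ᶠ to y)

  private
    round : ∀ x → from (to x) ≈ x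
    round = strictlyInverseʳ

  isPermutation? : ∀ {f} → Congruent _≈_ _≈_ f → Dec (IsPermutation f)
  isPermutation? {f} f-cong = injective? ×-dec surjective?
    where
    injective⁺ : (∀ i j → f (from i) ≈ f (from j) → from i ≈ from j) →
                 Injective _≈_ _≈_ f
    injective⁺ inj {x} {y} e =
      trans (sym (round x)) (trans (inj (to x) (to y) e′) (round y))
      where
      e′ : f (from (to x)) ≈ f (from (to y))
      e′ = trans (f-cong (round x)) (trans e (sym (f-cong (round y))))

    injective? : Dec (Injective _≈_ _≈_ f)
    injective? = map′ injective⁺ (λ inj i j → inj)
      (all? λ i → all? λ j → (f (from i) ≟ f (from j)) →-dec (from i ≟ from j))

    surjective⁺ : (∀ j → ∃ λ i → f (from i) ≈ from j) → Surjective _≈_ _≈_ f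
    surjective⁺ sur y with sur (to y)
    ... | i , e = from i , λ z≈ → trans (f-cong z≈) (trans e (round y))

    surjective⁻ : Surjective _≈_ _≈_ f → ∀ j → ∃ λ i → f (from i) ≈ from j
    surjective⁻ sur j with sur (from j)
    ... | x , e = to x , e (round x)

    surjective? : Dec (Surjective _≈_ _≈_ f)
    surjective? = map′ surjective⁺ surjective⁻
      (all? λ j → any? λ i → f (from i) ≟ from j)

  eval-cong : ∀ H → Congruent _≈_ _≈_ (eval H)
  eval-cong []       x≈y = refl
  eval-cong (a ∷ as) x≈y = +-congˡ (*-cong x≈y (eval-cong as x≈y))

  Tr-cong : Congruent _≈_ _≈_ Tr
  Tr-cong x≈y = sum-cong-≋ {n} λ i → ^-congˡ (q ^ toℕ i) x≈y

  P? : ∀ H → Decidable (P H)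
  P? H γ = isPermutation? λ x≈y → +-cong x≈y (*-congˡ (Tr-cong (eval-cong H x≈y)))

  elements : List Carrier
  elements = tabulate from

  -- `elements` lists every element exactly once (up to ≈), so for predicates
  -- invariant under ≈ this is the number of elements satisfying them.
  card : ∀ {p} {A : Pred Carrier p} → Decidable A → ℕ
  card A? = length (filter A? elements)

  ∣P∣ : Polynomial → ℕ
  ∣P∣ H = card (P? H)

{-# OPTIONS --safe #-}

-- Write f = Tr ∘ H and call γ bad if x + γ f(x) is not a permutation.  For y with f(y) ≠ a, the
-- affine bijection x ↦ (x - y) / (f(y) - a) of K sends the fibre of f over a into the bad values;
-- since the fibres over the q elements of F_q exhaust K, there are at least q ^ (n - 1) bad values.
-- If there are exactly that many, all these maps are onto the bad values, which means that
-- f(y + γ a) = f(y) - a for bad γ, all y and all a in F_q.  As every quotient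
-- (x - y) / (f(y) - f(x)) is bad, f is affine.  Conversely, if g = f - f(0) is linear, bad values
-- satisfy g(γ) = -1, and the fibres of g over F_q all have the same size.
module Submission where

open import Defs
open import Algebra.Apartness.Bundles using (HeytingField)
open import Data.Nat.Base using (ℕ; _≤_; _∸_; _^_)
open import Data.Product.Base using (∃; _×_)
open import Function.Bundles using (_⇔_)
open import Relation.Binary.PropositionalEquality using (_≡_)
open import Relation.Nullary.Negation.Core using (¬_)

open import Algebra.Bundles using (CommutativeMonoid; CommutativeRing; CommutativeSemiring)
open import Algebra.Solver.Ring.AlmostCommutativeRing
  using (fromCommutativeRing; _-Raw-AlmostCommutative⟶_)
open import Data.Fin.Base using (Fin; zero; suc; toℕ; fromℕ; punchIn)
open import Data.Fin.Properties
  using (any?; punchInᵢ≢i; toℕ-inject₁; toℕ-fromℕ; toℕ<n; toℕ-injective)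
open import Data.Integer.Base as ℤ using (ℤ; +_; -[1+_])
import Data.Integer.Properties as ℤ
open import Data.List.Base using (length; filter; tabulate)
open import Data.Maybe.Base as Maybe using (Maybe)
open import Data.Nat.Base as ℕ using (zero; suc; z≤n; s≤s)
open import Data.Nat.Combinatorics using (_C_; nCk≡n!/k![n-k]!; k![n∸k]!∣n!; nCn≡1)
open import Data.Nat.Divisibility using (_∣_; divides-refl; m∣m*n; ∣⇒≤; ∣1⇒≡1)
open import Data.Nat.DivMod using (m/n*n≡m)
open import Data.Nat.Primality using (Prime; prime⇒nonTrivial; prime⇒nonZero; euclidsLemma)
import Data.Nat.Properties as ℕ
open import Data.Product.Base using (∃₂; _,_; proj₁; proj₂)
open import Data.Sum.Base using (_⊎_; inj₁; inj₂; [_,_]′)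
open import Function.Base using (_∘_; const)
open import Function.Bundles using (Equivalence; Inverse; mk⇔)
open import Function.Construct.Composition using (inverse)
open import Function.Construct.Symmetry using () renaming (inverse to symmetric)
open import Function.Definitions using (Congruent)
open import Level using (Level; _⊔_)
open import Relation.Binary.Bundles using (Setoid)
open import Relation.Binary.Consequences using (dec⇒weaklyDec)
open import Relation.Binary.Definitions using (_Respects_)
open import Relation.Binary.PropositionalEquality as ≡ using (_≢_)
open import Relation.Nullary using (Dec; yes; no; contradiction)
open import Relation.Nullary.Decidable using (¬?; decidable-stable)
open import Relation.Unary using (Pred; Decidable)
import Algebra.Apartness.Properties.HeytingCommutativeRing as Apartness
import Algebra.Properties.CommutativeMonoid.Sum as Sum
import Algebra.Properties.CommutativeSemiring.Binomial as Binomial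
import Algebra.Properties.CommutativeSemiring.Exp as Exp
import Algebra.Properties.Monoid.Sum as MonoidSum
import Algebra.Properties.Ring as RingProperties
import Algebra.Properties.Semiring.Mult as Mult
import Algebra.Properties.Semiring.Mult.TCOptimised as Multiples
import Algebra.Properties.Semiring.Sum as SemiringSum
import Algebra.Solver.Ring as RingSolver
import Relation.Binary.Reasoning.Setoid as SetoidReasoning

-- The exact size of F_q, here the set of fixed points of x ↦ x ^ q, is what makes the counts meet:
-- at most `q` such points give the bound and the rigidity of the equality case, at least `q` give
-- the converse. Beyond the field axioms only the number of elements of `K` is given, so this size,
-- the characteristic and x ^ (q ^ n) = x are all recovered by permuting or counting elements. `K`
-- is a constructive field, hence case distinctions are decided through the enumeration.
-- Cardinalities are sums of 0-1 indicators: a bijection becomes a reindexing, and an inequality of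
-- sums that is tight is tight in every term. That the linear maps into F_q are the maps x ↦ Tr(u x)
-- is shown with an explicit u = -∑ f(y) / y instead of a dimension count; this rests on ∑ Tr(z) / z
-- = -1 over nonzero z.

-- Ring identities with integer coefficients

module IntegerSolver {c ℓ} (R : CommutativeRing c ℓ) where
  open CommutativeRing R
  open RingProperties (CommutativeRing.ring R)
  open Multiples semiring renaming (_×_ to _·_)
  open SetoidReasoning setoid

  -- With the optimised multiples, `con (+ 0)` and `con (+ 1)` evaluate to `0#` and `1#` on the
  -- nose, as the goals passed to `solve` require.
  fromℤ : ℤ → Carrier
  fromℤ (+ n)    = n · 1#
  fromℤ -[1+ n ] = - (suc n · 1#)

  private
    cancel : ∀ a b d → (a + b) - (a + d) ≈ b - d
    cancel a b d = begin
      (a + b) - (a + d)      ≈⟨ +-cong (+-comm a b) (sym (-‿+-comm a d)) ⟩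
      (b + a) + (- a + - d)  ≈⟨ +-assoc b a _ ⟩
      b + (a + (- a + - d))  ≈⟨ +-congˡ (+-assoc a (- a) (- d)) ⟨
      b + (a - a + - d)      ≈⟨ +-congˡ (+-congʳ (-‿inverseʳ a)) ⟩
      b + (0# + - d)         ≈⟨ +-congˡ (+-identityˡ (- d)) ⟩
      b - d                  ∎

    x≈x-0 : ∀ x → x ≈ x - 0#
    x≈x-0 x = sym (trans (+-congˡ -0#≈0#) (+-identityʳ x))

  fromℤ-⊖ : ∀ m n → fromℤ (m ℤ.⊖ n) ≈ m · 1# - n · 1#
  fromℤ-⊖ m       zero    = x≈x-0 (m · 1#)
  fromℤ-⊖ zero    (suc n) = sym (+-identityˡ _)
  fromℤ-⊖ (suc m) (suc n) = begin
    fromℤ (suc m ℤ.⊖ suc n)            ≡⟨ ≡.cong fromℤ (ℤ.[1+m]⊖[1+n]≡m⊖n m n) ⟩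
    fromℤ (m ℤ.⊖ n)                    ≈⟨ fromℤ-⊖ m n ⟩
    m · 1# - n · 1#                    ≈⟨ cancel 1# _ _ ⟨
    (1# + m · 1#) - (1# + n · 1#)      ≈⟨ +-cong (1+× m 1#) (-‿cong (1+× n 1#)) ⟨
    suc m · 1# - suc n · 1#            ∎

  fromℤ-neg : ∀ i → fromℤ (ℤ.- i) ≈ - fromℤ i
  fromℤ-neg (+ zero)   = sym -0#≈0#
  fromℤ-neg (+ suc n)  = refl
  fromℤ-neg -[1+ n ]   = sym (-‿involutive _)

  fromℤ-+ : ∀ i j → fromℤ (i ℤ.+ j) ≈ fromℤ i + fromℤ j
  fromℤ-+ (+ m)    (+ n)    = ×-homo-+ 1# m n
  fromℤ-+ (+ m)    -[1+ n ] = fromℤ-⊖ m (suc n)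
  fromℤ-+ -[1+ m ] (+ n)    = trans (fromℤ-⊖ n (suc m)) (+-comm _ _)
  fromℤ-+ -[1+ m ] -[1+ n ] = begin
    fromℤ (-[1+ m ] ℤ.+ -[1+ n ])        ≡⟨ ≡.cong fromℤ (ℤ.neg-distrib-+ (+ suc m) (+ suc n)) ⟨
    - ((suc m ℕ.+ suc n) · 1#)           ≈⟨ -‿cong (×-homo-+ 1# (suc m) (suc n)) ⟩
    - (suc m · 1# + suc n · 1#)          ≈⟨ -‿+-comm _ _ ⟨
    - (suc m · 1#) + - (suc n · 1#)      ∎

  fromℤ-+* : ∀ m j → fromℤ (+ m ℤ.* j) ≈ fromℤ (+ m) * fromℤ j
  fromℤ-+* m (+ n)    = trans (reflexive (≡.cong fromℤ (≡.sym (ℤ.pos-* m n)))) (×1-homo-* m n)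
  fromℤ-+* m -[1+ n ] = begin
    fromℤ (+ m ℤ.* ℤ.- (+ suc n))  ≡⟨ ≡.cong fromℤ (ℤ.neg-distribʳ-* (+ m) (+ suc n)) ⟨
    fromℤ (ℤ.- (+ m ℤ.* + suc n))  ≈⟨ fromℤ-neg (+ m ℤ.* + suc n) ⟩
    - fromℤ (+ m ℤ.* + suc n)      ≈⟨ -‿cong (fromℤ-+* m (+ suc n)) ⟩
    - (m · 1# * (suc n · 1#))      ≈⟨ -‿distribʳ-* _ _ ⟩
    m · 1# * - (suc n · 1#)        ∎

  fromℤ-* : ∀ i j → fromℤ (i ℤ.* j) ≈ fromℤ i * fromℤ j
  fromℤ-* (+ m)    j = fromℤ-+* m j
  fromℤ-* -[1+ m ] j = begin
    fromℤ (ℤ.- (+ suc m) ℤ.* j)    ≡⟨ ≡.cong fromℤ (ℤ.neg-distribˡ-* (+ suc m) j) ⟨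
    fromℤ (ℤ.- (+ suc m ℤ.* j))    ≈⟨ fromℤ-neg (+ suc m ℤ.* j) ⟩
    - fromℤ (+ suc m ℤ.* j)        ≈⟨ -‿cong (fromℤ-+* (suc m) j) ⟩
    - (suc m · 1# * fromℤ j)       ≈⟨ -‿distribˡ-* _ _ ⟩
    - (suc m · 1#) * fromℤ j       ∎

  fromℤ-homomorphism : ℤ.+-*-rawRing -Raw-AlmostCommutative⟶ fromCommutativeRing R
  fromℤ-homomorphism = record
    { ⟦_⟧    = fromℤ
    ; +-homo = fromℤ-+
    ; *-homo = fromℤ-*
    ; -‿homo = fromℤ-neg
    ; 0-homo = refl
    ; 1-homo = refl
    }

  private
    fromℤ≟ : ∀ i j → Maybe (fromℤ i ≈ fromℤ j)
    fromℤ≟ i j = Maybe.map (reflexive ∘ ≡.cong fromℤ) (dec⇒weaklyDec ℤ._≟_ i j)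

  open RingSolver ℤ.+-*-rawRing (fromCommutativeRing R) fromℤ-homomorphism fromℤ≟ public
    using (solve; _:=_; _:+_; _:*_; _:-_; :-_; con)

-- Finite sums and indicators

module ℕSum = Sum ℕ.+-0-commutativeMonoid

private
  variable
    α β p₁ : Level
    A B D : Set p₁
    k : ℕ

module _ (M : CommutativeMonoid α β) where
  open CommutativeMonoid M
  open Sum M

  sum-single : ∀ (t : Fin k → Carrier) i → (∀ j → j ≢ i → t j ≈ ε) → sum t ≈ t i
  sum-single {suc k} t i zeros = begin
    sum t                               ≈⟨ sum-remove {i = i} t ⟩
    t i ∙ sum (λ j → t (punchIn i j))   ≈⟨ ∙-congˡ (sum-cong-≋ λ j → zeros _ (punchInᵢ≢i i j)) ⟩
    t i ∙ sum {k} (λ _ → ε)             ≈⟨ ∙-congˡ (sum-replicate-zero k) ⟩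
    t i ∙ ε                             ≈⟨ identityʳ (t i) ⟩
    t i                                 ∎
    where open SetoidReasoning setoid

sum-mono : ∀ {s t : Fin k → ℕ} → (∀ i → s i ℕ.≤ t i) → ℕSum.sum s ℕ.≤ ℕSum.sum t
sum-mono {zero}  s≤t = z≤n
sum-mono {suc k} s≤t = ℕ.+-mono-≤ (s≤t zero) (sum-mono (s≤t ∘ suc))

-- When termwise bounds have totals that meet, no term has slack. The equality case draws all its
-- rigidity from this.
sum-tight : ∀ {s t : Fin k → ℕ} → (∀ i → s i ℕ.≤ t i) →
            ℕSum.sum t ℕ.≤ ℕSum.sum s → ∀ i → s i ≡ t i
sum-tight {suc k} {s} {t} s≤t Σt≤Σs zero = ℕ.≤-antisym (s≤t zero)
  (ℕ.+-cancelʳ-≤ (ℕSum.sum (t ∘ suc)) _ _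
    (ℕ.≤-trans Σt≤Σs (ℕ.+-monoʳ-≤ (s zero) (sum-mono (s≤t ∘ suc)))))
sum-tight {suc k} {s} {t} s≤t Σt≤Σs (suc i) = sum-tight (s≤t ∘ suc)
  (ℕ.+-cancelˡ-≤ (t zero) _ _
    (ℕ.≤-trans Σt≤Σs (ℕ.+-monoˡ-≤ (ℕSum.sum (s ∘ suc)) (s≤t zero)))) i

-- The Iverson bracket; it turns double counting into an exchange of summations.
[_] : Dec A → ℕ
[ yes _ ] = 1
[ no  _ ] = 0

[]-yes : (A? : Dec A) → A → [ A? ] ≡ 1
[]-yes (yes _) _ = ≡.refl
[]-yes (no ¬a) a = contradiction a ¬a

[]-no : (A? : Dec A) → ¬ A → [ A? ] ≡ 0
[]-no (yes a) ¬a = contradiction a ¬a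
[]-no (no  _) _  = ≡.refl

[]-positive : (A? : Dec A) → 1 ℕ.≤ [ A? ] → A
[]-positive (yes a) _ = a

[]-mono : (A? : Dec A) (B? : Dec B) → (A → B) → [ A? ] ℕ.≤ [ B? ]
[]-mono (yes a) B? f = ℕ.≤-reflexive (≡.sym ([]-yes B? (f a)))
[]-mono (no  _) B? f = z≤n

[]-mono-⊎ : (A? : Dec A) (B? : Dec B) (D? : Dec D) → (A → B ⊎ D) → [ A? ] ℕ.≤ [ B? ] ℕ.+ [ D? ]
[]-mono-⊎ (no  _) B? D? f = z≤n
[]-mono-⊎ (yes a) B? D? f with f a
... | inj₁ b = ℕ.≤-trans (ℕ.≤-reflexive (≡.sym ([]-yes B? b))) (ℕ.m≤m+n _ _)
... | inj₂ c = ℕ.≤-trans (ℕ.≤-reflexive (≡.sym ([]-yes D? c))) (ℕ.m≤n+m _ _)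

[]-complement : (A? : Dec A) → [ A? ] ℕ.+ [ ¬? A? ] ≡ 1
[]-complement (yes _) = ≡.refl
[]-complement (no  _) = ≡.refl

-- The bridge from the list length in `card` to sums of indicators, in which all later counting is
-- done.
length-filter-tabulate : ∀ {X : Set α} {A : Pred X p₁} (A? : Decidable A) (t : Fin k → X) →
                         length (filter A? (tabulate t)) ≡ ℕSum.sum (λ i → [ A? (t i) ])
length-filter-tabulate {k = zero}  A? t = ≡.refl
length-filter-tabulate {k = suc k} A? t with A? (t zero)
... | yes _ = ≡.cong suc (length-filter-tabulate A? (t ∘ suc))
... | no  _ = length-filter-tabulate A? (t ∘ suc)

-- Totals and counts over a finite setoid

module Finite {c ℓ} (S : Setoid c ℓ) {N : ℕ} (enum : Inverse S (≡.setoid (Fin N))) where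
  open Setoid S
  open Inverse enum using (to; from; to-cong; strictlyInverseˡ; strictlyInverseʳ)

  module Total (M : CommutativeMonoid α β) where
    private module M = CommutativeMonoid M
    open Sum M
    open SetoidReasoning M.setoid

    total : (Carrier → M.Carrier) → M.Carrier
    total t = sum (t ∘ from)

    total-cong : ∀ {s t} → (∀ x → s x M.≈ t x) → total s M.≈ total t
    total-cong s≈t = sum-cong-≋ (s≈t ∘ from)

    total-∙ : ∀ s t → total (λ x → s x M.∙ t x) M.≈ total s M.∙ total t
    total-∙ s t = ∑-distrib-+ (s ∘ from) (t ∘ from)

    -- Conjugation by `enum` turns `π` into a permutation of indices. The round trip through an
    -- index returns an element only up to `≈`, whence the congruence of `t`.
    total-permute : ∀ (π : Inverse S S) {t} → Congruent _≈_ M._≈_ t →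
                    total t M.≈ total (t ∘ Inverse.to π)
    total-permute π {t} t-cong = begin
      total t
        ≈⟨ sum-permute (t ∘ from) (inverse (symmetric enum) (inverse π enum)) ⟩
      sum (λ i → t (from (to (π.to (from i)))))
        ≈⟨ sum-cong-≋ {N} (λ i → t-cong (strictlyInverseʳ (π.to (from i)))) ⟩
      total (t ∘ π.to)                           ∎
      where module π = Inverse π

    total-single : ∀ {t} → Congruent _≈_ M._≈_ t → ∀ x →
                   (∀ y → ¬ y ≈ x → t y M.≈ M.ε) → total t M.≈ t x
    total-single {t} t-cong x zeros = begin
      total t         ≈⟨ sum-single M (t ∘ from) (to x) (λ j j≢ → zeros _ λ e →
                           j≢ (≡.trans (≡.sym (strictlyInverseˡ j)) (to-cong e))) ⟩
      t (from (to x)) ≈⟨ t-cong (strictlyInverseʳ x) ⟩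
      t x             ∎

  module #Total = Total ℕ.+-0-commutativeMonoid
  open #Total using () renaming (total to #total)

  count : {A : Pred Carrier p₁} → Decidable A → ℕ
  count A? = #total λ x → [ A? x ]

  private
    variable
      P Q R : Pred Carrier p₁

  #total-one : #total (const 1) ≡ N
  #total-one = ≡.trans (ℕSum.sum-replicate N) (×-one N)
    where
    open import Algebra.Properties.Monoid.Mult ℕ.+-0-monoid using () renaming (_×_ to _·_)
    ×-one : ∀ k → k · 1 ≡ k
    ×-one zero    = ≡.refl
    ×-one (suc k) = ≡.cong suc (×-one k)

  []-cong : (P? : Decidable P) → P Respects _≈_ → Congruent _≈_ _≡_ (λ x → [ P? x ])
  []-cong P? resp {x} {y} x≈y =
    ℕ.≤-antisym ([]-mono (P? x) (P? y) (resp x≈y)) ([]-mono (P? y) (P? x) (resp (sym x≈y)))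

  count-mono : (P? : Decidable P) (Q? : Decidable Q) → (∀ {x} → P x → Q x) →
               count P? ℕ.≤ count Q?
  count-mono P? Q? P⊆Q = sum-mono λ i → []-mono (P? (from i)) (Q? (from i)) P⊆Q

  count-∪ : (P? : Decidable P) (Q? : Decidable Q) (R? : Decidable R) →
            (∀ {x} → P x → Q x ⊎ R x) → count P? ℕ.≤ count Q? ℕ.+ count R?
  count-∪ P? Q? R? P⊆Q∪R = ℕ.≤-trans
    (sum-mono λ i → []-mono-⊎ (P? (from i)) (Q? (from i)) (R? (from i)) P⊆Q∪R)
    (ℕ.≤-reflexive (#Total.total-∙ (λ x → [ Q? x ]) (λ x → [ R? x ])))

  count-none : (P? : Decidable P) → (∀ x → ¬ P x) → count P? ≡ 0
  count-none P? none = ≡.trans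
    (#Total.total-cong λ x → []-no (P? x) (none x)) (ℕSum.sum-replicate-zero N)

  count-all : (P? : Decidable P) → (∀ x → P x) → count P? ≡ N
  count-all P? all = ≡.trans (#Total.total-cong λ x → []-yes (P? x) (all x)) #total-one

  count-one : (P? : Decidable P) → P Respects _≈_ →
              ∀ x → P x → (∀ y → P y → y ≈ x) → count P? ≡ 1
  count-one P? resp x px unique = ≡.trans
    (#Total.total-single ([]-cong P? resp) x λ y y≉x → []-no (P? y) (y≉x ∘ unique y))
    ([]-yes (P? x) px)

  count-complement : (P? : Decidable P) → count P? ℕ.+ count (¬? ∘ P?) ≡ N
  count-complement P? = ≡.trans (≡.sym (#Total.total-∙ (λ x → [ P? x ]) (λ x → [ ¬? (P? x) ])))
    (≡.trans (#Total.total-cong ([]-complement ∘ P?)) #total-one)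

  count-transport : (P? : Decidable P) (Q? : Decidable Q) → Q Respects _≈_ →
                    (π : Inverse S S) → (∀ {x} → P x → Q (Inverse.to π x)) →
                    count P? ℕ.≤ count Q?
  count-transport P? Q? Q-resp π P⇒Q = ℕ.≤-trans
    (count-mono P? (Q? ∘ Inverse.to π) P⇒Q)
    (ℕ.≤-reflexive (≡.sym (#Total.total-permute π ([]-cong Q? Q-resp))))

  -- An injection into a set that is no larger is onto. In indicators: [P x] ≤ [Q (π x)] for every
  -- x, and the totals agree, so `sum-tight` makes each pair equal.
  count-transport-tight : (P? : Decidable P) (Q? : Decidable Q) → P Respects _≈_ → Q Respects _≈_ →
                          (π : Inverse S S) → (∀ {x} → P x → Q (Inverse.to π x)) →
                          count Q? ℕ.≤ count P? → ∀ {x} → Q (Inverse.to π x) → P x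
  count-transport-tight P? Q? P-resp Q-resp π P⇒Q #Q≤#P {x} qx =
    P-resp (strictlyInverseʳ x) ([]-positive (P? (from (to x)))
      (ℕ.≤-reflexive (≡.trans (≡.sym ([]-yes (Q? _) qx′)) (≡.sym (tight (to x))))))
    where
    qx′ = Q-resp (Inverse.to-cong π (sym (strictlyInverseʳ x))) qx
    tight = sum-tight (λ i → []-mono (P? (from i)) (Q? (Inverse.to π (from i))) P⇒Q)
      (ℕ.≤-trans (ℕ.≤-reflexive (≡.sym (#Total.total-permute π ([]-cong Q? Q-resp)))) #Q≤#P)

-- Binomial coefficients modulo a prime and additive powers

prime∤k! : ∀ {p} → Prime p → ∀ k → k ℕ.< p → ¬ p ∣ k ℕ.!
prime∤k! pr zero    k<p p∣1 = ℕ.nonTrivial⇒≢1 {{prime⇒nonTrivial pr}} (∣1⇒≡1 p∣1)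
prime∤k! pr (suc k) k<p p∣k! with euclidsLemma (suc k) (k ℕ.!) pr p∣k!
... | inj₁ p∣1+k = ℕ.<⇒≱ k<p (∣⇒≤ p∣1+k)
... | inj₂ p∣k!  = prime∤k! pr k (ℕ.<-trans (ℕ.n<1+n k) k<p) p∣k!

-- `p` divides p! = (p C k) k! (p - k)! but neither of the two factorials of smaller numbers.
prime∣pCk : ∀ {p} → Prime p → ∀ k → 1 ℕ.≤ k → k ℕ.< p → p ∣ p C k
prime∣pCk {zero}       pr k 0<k ()
prime∣pCk {p@(suc p-1)} pr k 0<k k<p
  with euclidsLemma (p C k) (k ℕ.! ℕ.* (p ℕ.∸ k) ℕ.!) pr (≡.subst (p ∣_) (≡.sym p!≡) (m∣m*n (p-1 ℕ.!)))
  where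
  instance _ = k ℕ.!* (p ℕ.∸ k) !≢0
  p!≡ : (p C k) ℕ.* (k ℕ.! ℕ.* (p ℕ.∸ k) ℕ.!) ≡ p ℕ.!
  p!≡ = ≡.trans (≡.cong (ℕ._* (k ℕ.! ℕ.* (p ℕ.∸ k) ℕ.!)) (nCk≡n!/k![n-k]! (ℕ.<⇒≤ k<p)))
                (m/n*n≡m (k![n∸k]!∣n! (ℕ.<⇒≤ k<p)))
... | inj₁ p∣pCk = p∣pCk
... | inj₂ p∣k![p-k]! with euclidsLemma (k ℕ.!) ((p ℕ.∸ k) ℕ.!) pr p∣k![p-k]!
...   | inj₁ p∣k!     = contradiction p∣k! (prime∤k! pr k k<p)
...   | inj₂ p∣[p-k]! = contradiction p∣[p-k]! (prime∤k! pr (p ℕ.∸ k) (ℕ.∸-monoʳ-< 0<k (ℕ.<⇒≤ k<p)))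

module _ (M : CommutativeMonoid α β) where
  open CommutativeMonoid M
  open Sum M

  sum-last : ∀ k (u : ℕ → Carrier) → sum {suc k} (u ∘ toℕ) ≈ sum {k} (u ∘ toℕ) ∙ u k
  sum-last k u = trans (sum-init-last {k} (u ∘ toℕ)) (∙-cong
    (sum-cong-≋ {k} λ i → reflexive (≡.cong u (toℕ-inject₁ i)))
    (reflexive (≡.cong u (toℕ-fromℕ k))))

module Characteristic {c ℓ} (S : CommutativeSemiring c ℓ) where
  open CommutativeSemiring S hiding (zero)
  open Exp S renaming (_^_ to _^ᴿ_)
  open Mult semiring renaming (_×_ to _·_)
  open Sum +-commutativeMonoid
  open SetoidReasoning setoid

  Additive : ℕ → Set (c ⊔ ℓ)
  Additive e = ∀ x y → (x + y) ^ᴿ e ≈ x ^ᴿ e + y ^ᴿ e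

  additive-* : ∀ d e → Additive d → Additive e → Additive (d ℕ.* e)
  additive-* d e add-d add-e x y = begin
    (x + y) ^ᴿ (d ℕ.* e)          ≈⟨ ^-assocʳ (x + y) d e ⟨
    ((x + y) ^ᴿ d) ^ᴿ e            ≈⟨ ^-congˡ e (add-d x y) ⟩
    (x ^ᴿ d + y ^ᴿ d) ^ᴿ e          ≈⟨ add-e (x ^ᴿ d) (y ^ᴿ d) ⟩
    (x ^ᴿ d) ^ᴿ e + (y ^ᴿ d) ^ᴿ e    ≈⟨ +-cong (^-assocʳ x d e) (^-assocʳ y d e) ⟩
    x ^ᴿ (d ℕ.* e) + y ^ᴿ (d ℕ.* e) ∎

  additive-^ : ∀ d → Additive d → ∀ k → Additive (d ℕ.^ k)
  additive-^ d add zero    x y = distribʳ 1# x y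
  additive-^ d add (suc k) = additive-* d (d ℕ.^ k) add (additive-^ d add k)

  ∣⇒×≈0 : ∀ {d e} → d ∣ e → d · 1# ≈ 0# → ∀ x → e · x ≈ 0#
  ∣⇒×≈0 {d} (divides-refl k) d×1≈0 x = begin
    (k ℕ.* d) · x   ≈⟨ ×-assocˡ x k d ⟨
    k · (d · x)     ≈⟨ ×-congʳ k (×-congʳ d (*-identityˡ x)) ⟨
    k · (d · (1# * x)) ≈⟨ ×-congʳ k (×-assoc-* d 1# x) ⟨
    k · (d · 1# * x) ≈⟨ ×-congʳ k (*-congʳ d×1≈0) ⟩
    k · (0# * x)    ≈⟨ ×-congʳ k (zeroˡ x) ⟩
    k · 0#          ≈⟨ sum-replicate k ⟨
    sum {k} (const 0#)  ≈⟨ sum-replicate-zero k ⟩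
    0#              ∎

  -- Every inner term of the binomial expansion has a coefficient divisible by `p`. What survives is
  -- term `zero`, equal to y ^ p, and the last term, equal to x ^ p.
  additive-prime : ∀ {p} → Prime p → p · 1# ≈ 0# → Additive p
  additive-prime {zero}        pr p≈0 x y = contradiction ≡.refl (ℕ.≢-nonZero⁻¹ 0 {{prime⇒nonZero pr}})
  additive-prime {p@(suc p-1)} pr p≈0 x y = begin
    (x + y) ^ᴿ p                              ≈⟨ Binomial.theorem S p x y ⟩
    term zero + sum (term ∘ suc)
      ≈⟨ +-cong first (trans (sum-single +-commutativeMonoid _ (fromℕ p-1) middle) final) ⟩
    y ^ᴿ p + x ^ᴿ p                            ≈⟨ +-comm _ _ ⟩
    x ^ᴿ p + y ^ᴿ p                            ∎
    where
    term = Binomial.binomialTerm S x y p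

    first : term zero ≈ y ^ᴿ p
    first = trans (×-homo-1 _) (*-identityˡ _)

    middle : ∀ j → j ≢ fromℕ p-1 → term (suc j) ≈ 0#
    middle j j≢ = ∣⇒×≈0 (prime∣pCk pr (suc (toℕ j)) (s≤s z≤n) (s≤s (ℕ.≤∧≢⇒< (ℕ.s≤s⁻¹ (toℕ<n j))
      λ e → j≢ (toℕ-injective (≡.trans e (≡.sym (toℕ-fromℕ p-1))))))) p≈0 _

    final : term (suc (fromℕ p-1)) ≈ x ^ᴿ p
    final rewrite toℕ-fromℕ p-1 | nCn≡1 p | ℕ.n∸n≡0 p-1 = trans (×-homo-1 _) (*-identityʳ _)

  0^≈0 : ∀ e → .{{ℕ.NonZero e}} → 0# ^ᴿ e ≈ 0#
  0^≈0 (suc e) = zeroˡ (0# ^ᴿ e)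

  1^≈1 : ∀ e → 1# ^ᴿ e ≈ 1#
  1^≈1 zero    = refl
  1^≈1 (suc e) = trans (*-identityˡ _) (1^≈1 e)

  sum-^ : ∀ e → .{{ℕ.NonZero e}} → Additive e → ∀ {k} (t : Fin k → Carrier) →
          sum t ^ᴿ e ≈ sum (λ i → t i ^ᴿ e)
  sum-^ e add {zero}  t = 0^≈0 e
  sum-^ e add {suc k} t = trans (add _ _) (+-congˡ (sum-^ e add (t ∘ suc)))

-- Polynomial functions

module PolynomialFunctions {c ℓ} (R : CommutativeRing c ℓ) where
  open CommutativeRing R hiding (zero)
  open Exp commutativeSemiring using () renaming (_^_ to _^ᴿ_)
  open Sum +-commutativeMonoid
  open IntegerSolver R

  -- f is given by a polynomial of formal degree d, with coefficient a (possibly zero) of x ^ d.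
  IsPolynomial : ℕ → Carrier → (Carrier → Carrier) → Set (c ⊔ ℓ)
  IsPolynomial zero    a f = ∀ x → f x ≈ a
  IsPolynomial (suc d) a f = ∃₂ λ b g → IsPolynomial d a g × (∀ x → f x ≈ b + x * g x)

  private
    variable
      d e : ℕ
      u v : Carrier
      f g : Carrier → Carrier

  poly-cong : u ≈ v → (∀ x → f x ≈ g x) → IsPolynomial d u f → IsPolynomial d v g
  poly-cong {d = zero}  u≈v f≈g f≈u = λ x → trans (sym (f≈g x)) (trans (f≈u x) u≈v)
  poly-cong {d = suc d} u≈v f≈g (b , h , poly , f≈) =
    b , h , poly-cong {d = d} u≈v (λ x → refl) poly , λ x → trans (sym (f≈g x)) (f≈ x)

  poly-congruent : ∀ d → IsPolynomial d u f → Congruent _≈_ _≈_ f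
  poly-congruent zero    f≈u {x} {y} x≈y = trans (f≈u x) (sym (f≈u y))
  poly-congruent (suc d) (b , g , poly , f≈) {x} {y} x≈y = trans (f≈ x)
    (trans (+-congˡ (*-cong x≈y (poly-congruent d poly x≈y))) (sym (f≈ y)))

  poly-zero : ∀ d → IsPolynomial d 0# (const 0#)
  poly-zero zero    x = refl
  poly-zero (suc d) = 0# , const 0# , poly-zero d , λ x → sym (trans (+-identityˡ _) (zeroʳ x))

  poly-power : ∀ d → IsPolynomial d 1# (_^ᴿ d)
  poly-power zero    x = refl
  poly-power (suc d) = 0# , _^ᴿ d , poly-power d , λ x → sym (+-identityˡ _)

  poly-raise : ∀ d → IsPolynomial d u f → IsPolynomial (suc d) 0# f
  poly-raise {u} zero f≈u =
    u , const 0# , (λ x → refl) , λ x → trans (f≈u x) (sym (trans (+-congˡ (zeroʳ x)) (+-identityʳ u)))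
  poly-raise (suc d) (b , g , poly , f≈) = b , g , poly-raise d poly , f≈

  -- Padding with zero top coefficients brings summands to a common formal degree for `poly-+`,
  -- leaving the leading coefficient to the larger one.
  poly-< : d ℕ.<′ e → IsPolynomial d u f → IsPolynomial e 0# f
  poly-< {d = d} ℕ.<′-base       poly = poly-raise d poly
  poly-<         (ℕ.≤′-step d<e) poly = poly-raise _ (poly-< d<e poly)

  poly-+ : ∀ d → IsPolynomial d u f → IsPolynomial d v g → IsPolynomial d (u + v) (λ x → f x + g x)
  poly-+ zero    f≈u g≈v x = +-cong (f≈u x) (g≈v x)
  poly-+ (suc d) (b₁ , h₁ , poly₁ , f≈) (b₂ , h₂ , poly₂ , g≈) =
    b₁ + b₂ , _ , poly-+ d poly₁ poly₂ , λ x → trans (+-cong (f≈ x) (g≈ x))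
      (solve 5 (λ x b₁ b₂ h₁ h₂ → (b₁ :+ x :* h₁) :+ (b₂ :+ x :* h₂) := b₁ :+ b₂ :+ x :* (h₁ :+ h₂)) refl
        x b₁ b₂ (h₁ x) (h₂ x))

  poly-neg : ∀ d → IsPolynomial d u f → IsPolynomial d (- u) (λ x → - f x)
  poly-neg zero    f≈u x = -‿cong (f≈u x)
  poly-neg (suc d) (b , h , poly , f≈) =
    - b , _ , poly-neg d poly , λ x → trans (-‿cong (f≈ x))
      (solve 3 (λ x b h → :- (b :+ x :* h) := :- b :+ x :* :- h) refl x b (h x))

  -- Horner's scheme: if f = b + x g and g = g(r) + (x - r) h, then the quotient of f is g(r) + x h.
  -- It keeps the leading coefficient `u`, so `root-bound` can iterate the division.
  factor : ∀ d → IsPolynomial (suc d) u f → ∀ r →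
           ∃ λ h → IsPolynomial d u h × (∀ x → f x ≈ f r + (x - r) * h x)
  factor {u} {f} zero (b , g , g≈u , f≈) r = const u , (λ _ → refl) , λ x → begin
    f x                          ≈⟨ f≈ x ⟩
    b + x * g x                  ≈⟨ +-congˡ (*-congˡ (g≈u x)) ⟩
    b + x * u
      ≈⟨ solve 4 (λ b x r u → b :+ x :* u := (b :+ r :* u) :+ (x :- r) :* u) refl b x r u ⟩
    (b + r * u) + (x - r) * u    ≈⟨ +-congʳ (trans (f≈ r) (+-congˡ (*-congˡ (g≈u r)))) ⟨
    f r + (x - r) * u            ∎
    where open SetoidReasoning setoid
  factor {u} {f} (suc d) (b , g , poly , f≈) r with factor d poly r
  ... | h , poly-h , g≈ = _ , (g r , h , poly-h , λ x → refl) , λ x → begin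
    f x                                           ≈⟨ f≈ x ⟩
    b + x * g x                                   ≈⟨ +-congˡ (*-congˡ (g≈ x)) ⟩
    b + x * (g r + (x - r) * h x)                 ≈⟨ solve 5 (λ b x r gr hx →
                                                       b :+ x :* (gr :+ (x :- r) :* hx)
                                                       := (b :+ r :* gr) :+ (x :- r) :* (gr :+ x :* hx))
                                                       refl b x r (g r) (h x) ⟩
    (b + r * g r) + (x - r) * (g r + x * h x)     ≈⟨ +-congʳ (f≈ r) ⟨
    f r + (x - r) * (g r + x * h x)               ∎
    where open SetoidReasoning setoid

-- Decidable search, inverses and roots in a finite field

module DiscreteField
  {c ℓ₁ ℓ₂} (q n : ℕ) (K : HeytingField c ℓ₁ ℓ₂) (enum : HasSize K (q ℕ.^ n)) where

  open FiniteField q n K enum hiding (zero; ring) public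
  open Inverse enum using (to; from; strictlyInverseʳ) public
  open Finite setoid enum public
  open IntegerSolver (ring K) public using (solve; _:=_; _:+_; _:*_; _:-_; :-_; con)
  open PolynomialFunctions (ring K) public
  open Characteristic commutativeSemiring public
  open Exp commutativeSemiring public using (^-congˡ; ^-assocʳ; ^-distrib-*)
  private module K = HeytingField K
  open RingProperties (CommutativeRing.ring (ring K)) public
    using (-0#≈0#; x∙y⁻¹≈ε⇒x≈y; x≈y⇒x∙y⁻¹≈ε; +-cancelˡ; +-cancelʳ; -‿involutive)
  module ≈-Reasoning = SetoidReasoning setoid
  open ≈-Reasoning

  -- Exhaustive search stands in for excluded middle on existence statements.
  find : ∀ {a} {A : Carrier → Set a} → Decidable A → A Respects _≈_ → Dec (∃ A)
  find A? resp with any? (A? ∘ from)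
  ... | yes (i , ai) = yes (from i , ai)
  ... | no  none     = no λ (x , ax) → none (to x , resp (sym (strictlyInverseʳ x)) ax)

  1≉0 : ¬ 1# ≈ 0#
  1≉0 1≈0 = K.#-irrefl 1≈0 (Apartness.1#0 K.heytingCommutativeRing)

  -- The field inverts only elements apart from zero. If the search for an inverse fails, `x` cannot
  -- be apart from zero, and tightness makes it equal to zero.
  invertible : ∀ x → ¬ x ≈ 0# → ∃ λ y → y * x ≈ 1#
  invertible x x≉0 with find (λ y → y * x ≟ 1#) (λ y≈z yx≈1 → trans (*-congʳ (sym y≈z)) yx≈1)
  ... | yes found = found
  ... | no  none  = contradiction (proj₁ (K.tight x 0#) λ x#0 →
    let y , y[x-0]≈1 , _ = K.#⇒invertible x#0 in
    none (y , trans (*-congˡ (sym (trans (+-congˡ -0#≈0#) (+-identityʳ x)))) y[x-0]≈1)) x≉0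

  -- The convention `inv 0# ≈ 0#` makes z ↦ x * inv z a bijection of all of `K` for nonzero x, and
  -- removes the term at zero from sums of multiples of `inv z`.
  inv : Carrier → Carrier
  inv x with x ≟ 0#
  ... | yes _   = 0#
  ... | no  x≉0 = proj₁ (invertible x x≉0)

  inv-zero : ∀ {x} → x ≈ 0# → inv x ≈ 0#
  inv-zero {x} x≈0 with x ≟ 0#
  ... | yes _   = refl
  ... | no  x≉0 = contradiction x≈0 x≉0

  inv-inverse : ∀ {x} → ¬ x ≈ 0# → inv x * x ≈ 1#
  inv-inverse {x} x≉0 with x ≟ 0#
  ... | yes x≈0 = contradiction x≈0 x≉0
  ... | no  x≉0 = proj₂ (invertible x x≉0)

  *-cancelˡ : ∀ {x y z} → ¬ x ≈ 0# → x * y ≈ x * z → y ≈ z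
  *-cancelˡ {x} {y} {z} x≉0 xy≈xz = begin
    y                ≈⟨ unit y ⟩
    inv x * (x * y)  ≈⟨ *-congˡ xy≈xz ⟩
    inv x * (x * z)  ≈⟨ unit z ⟨
    z                ∎
    where
    unit : ∀ w → w ≈ inv x * (x * w)
    unit w = trans (sym (trans (*-congʳ (inv-inverse x≉0)) (*-identityˡ w))) (*-assoc _ _ _)

  inv-unique : ∀ {x y} → y * x ≈ 1# → inv x ≈ y
  inv-unique {x} {y} yx≈1 = *-cancelˡ x≉0 (begin
    x * inv x  ≈⟨ *-comm _ _ ⟩
    inv x * x  ≈⟨ inv-inverse x≉0 ⟩
    1#         ≈⟨ yx≈1 ⟨
    y * x      ≈⟨ *-comm _ _ ⟩
    x * y      ∎)
    where
    x≉0 : ¬ x ≈ 0#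
    x≉0 x≈0 = 1≉0 (trans (sym yx≈1) (trans (*-congˡ x≈0) (zeroʳ y)))

  inv-cong : ∀ {x y} → x ≈ y → inv x ≈ inv y
  inv-cong {x} {y} x≈y with x ≟ 0#
  ... | yes x≈0 = sym (inv-zero (trans (sym x≈y) x≈0))
  ... | no  x≉0 = trans (sym (inv-unique {x} (proj₂ (invertible x x≉0))))
                        (inv-unique (trans (*-congˡ x≈y) (inv-inverse (x≉0 ∘ trans x≈y))))

  *-zero-divisor : ∀ x y → x * y ≈ 0# → x ≈ 0# ⊎ y ≈ 0#
  *-zero-divisor x y xy≈0 with x ≟ 0#
  ... | yes x≈0 = inj₁ x≈0
  ... | no  x≉0 = inj₂ (*-cancelˡ x≉0 (trans xy≈0 (sym (zeroʳ x))))

  translation : Carrier → Inverse setoid setoid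
  translation w = record
    { to = _+ w
    ; from = _- w
    ; to-cong = +-congʳ
    ; from-cong = +-congʳ
    ; inverse = (λ {x} {y} y≈ → trans (+-congʳ y≈) (solve 2 (λ x w → (x :- w) :+ w := x) refl x w))
              , (λ {x} {y} y≈ → trans (+-congʳ y≈) (solve 2 (λ x w → (x :+ w) :- w := x) refl x w))
    }

  scaling : ∀ s t → t * s ≈ 1# → Inverse setoid setoid
  scaling s t ts≈1 = record
    { to = _* s
    ; from = _* t
    ; to-cong = *-congʳ
    ; from-cong = *-congʳ
    ; inverse = (λ {x} {y} y≈ → trans (*-congʳ y≈) (trans (*-assoc x t s) (trans (*-congˡ ts≈1) (*-identityʳ x))))
              , (λ {x} {y} y≈ → trans (*-congʳ y≈) (trans (*-assoc x s t) (trans (*-congˡ (trans (*-comm s t) ts≈1)) (*-identityʳ x))))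
    }

  -- A root `r` splits off a factor x - r; any other root is a root of the quotient, which has the
  -- same nonzero leading coefficient and formal degree one less.
  root-bound : ∀ d {u f} → IsPolynomial d u f → ¬ u ≈ 0# → count (λ x → f x ≟ 0#) ℕ.≤ d
  root-bound zero    {f = f} f≈u u≉0 = ℕ.≤-reflexive
    (count-none (λ x → f x ≟ 0#) λ x fx≈0 → u≉0 (trans (sym (f≈u x)) fx≈0))
  root-bound (suc d) {f = f} poly u≉0
    with find (λ x → f x ≟ 0#) (λ x≈y fx≈0 → trans (sym (poly-congruent (suc d) poly x≈y)) fx≈0)
  ... | no  none = ℕ.≤-trans (ℕ.≤-reflexive (count-none (λ x → f x ≟ 0#) λ x fx≈0 → none (x , fx≈0))) z≤n
  ... | yes (r , fr≈0) with factor d poly r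
  ...   | h , poly-h , f≈ = ℕ.≤-trans
          (count-∪ (λ x → f x ≟ 0#) (_≟ r) (λ x → h x ≟ 0#) split)
          (ℕ.+-mono-≤ (ℕ.≤-reflexive (count-one (_≟ r) (λ x≈y x≈r → trans (sym x≈y) x≈r)
             (r) refl (λ y y≈r → y≈r)))
            (root-bound d poly-h u≉0))
    where
    split : ∀ {x} → f x ≈ 0# → x ≈ r ⊎ h x ≈ 0#
    split {x} fx≈0 with *-zero-divisor (x - r) (h x)
      (trans (sym (+-identityˡ _)) (trans (+-congʳ (sym fr≈0)) (trans (sym (f≈ x)) fx≈0)))
    ... | inj₁ x-r≈0 = inj₁ (x∙y⁻¹≈ε⇒x≈y _ _ x-r≈0)
    ... | inj₂ hx≈0  = inj₂ hx≈0

-- Characteristic, the subfield F_q and the trace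

module TraceTheory
  {c ℓ₁ ℓ₂} (q m : ℕ) (q-primePower : IsPrimePower q)
  (K : HeytingField c ℓ₁ ℓ₂) (enum : HasSize K (q ℕ.^ suc m)) where

  open DiscreteField q (suc m) K enum public
  open Mult semiring using (×1-homo-*; ×-homo-1) renaming (_×_ to _·_)
  module +Total = Total +-commutativeMonoid
  module *Total = Total *-commutativeMonoid
  module +Sum = SemiringSum semiring
  open +Total public using (total)
  open ≈-Reasoning

  N : ℕ
  N = q ℕ.^ suc m

  private
    p r : ℕ
    p = proj₁ q-primePower
    r = proj₁ (proj₂ q-primePower)

    p-prime : Prime p
    p-prime = proj₁ (proj₂ (proj₂ q-primePower))

    q≡p^r : q ≡ p ℕ.^ r
    q≡p^r = proj₂ (proj₂ (proj₂ (proj₂ q-primePower)))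

  1<q : 1 ℕ.< q
  1<q = ≡.subst (1 ℕ.<_) (≡.sym q≡p^r) (ℕ.^-monoʳ-< p 1<p
    (proj₁ (proj₂ (proj₂ (proj₂ q-primePower)))))
    where
    1<p : 1 ℕ.< p
    1<p = ℕ.nonTrivial⇒n>1 p {{prime⇒nonTrivial p-prime}}

  instance
    q-nonZero : ℕ.NonZero q
    q-nonZero = ℕ.>-nonZero (ℕ.<-trans (s≤s z≤n) 1<q)

  -- The translation x ↦ x + 1 permutes K, so ∑ x = ∑ (x + 1).
  N×1≈0 : N · 1# ≈ 0#
  N×1≈0 = sym (+-cancelˡ (total (λ x → x)) 0# (N · 1#) (begin
    total (λ x → x) + 0#                ≈⟨ +-identityʳ _ ⟩
    total (λ x → x)                     ≈⟨ +Total.total-permute (translation 1#) {λ x → x} (λ x≈y → x≈y) ⟩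
    total (λ x → x + 1#)                ≈⟨ +Total.total-∙ (λ x → x) (const 1#) ⟩
    total (λ x → x) + total (const 1#)  ≈⟨ +-congˡ (+Sum.sum-replicate N) ⟩
    total (λ x → x) + N · 1#            ∎))

  -- `N` is a power of `p`, and multiples of `1#` multiply like integers; without zero divisors,
  -- factors `p` can be peeled off until one of them vanishes.
  p×1≈0 : p · 1# ≈ 0#
  p×1≈0 = descend (r ℕ.* suc m) (≡.subst (λ N → N · 1# ≈ 0#)
    (≡.trans (≡.cong (ℕ._^ suc m) q≡p^r) (ℕ.^-*-assoc p r (suc m))) N×1≈0)
    where
    descend : ∀ j → (p ℕ.^ j) · 1# ≈ 0# → p · 1# ≈ 0#
    descend zero    1≈0 = contradiction (trans (sym (×-homo-1 1#)) 1≈0) 1≉0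
    descend (suc j) p*p^j≈0 with *-zero-divisor _ _ (trans (sym (×1-homo-* p (p ℕ.^ j))) p*p^j≈0)
    ... | inj₁ p≈0   = p≈0
    ... | inj₂ p^j≈0 = descend j p^j≈0

  additive-q : Additive q
  additive-q = ≡.subst Additive (≡.sym q≡p^r) (additive-^ p (additive-prime p-prime p×1≈0) r)

  -- Isolates the entry at zero, so that products and sums over the nonzero elements can be written
  -- as totals over `K`.
  ifZero : Carrier → Carrier → Carrier → Carrier
  ifZero x a b with x ≟ 0#
  ... | yes _ = a
  ... | no  _ = b

  ifZero-zero : ∀ {x a b} → x ≈ 0# → ifZero x a b ≈ a
  ifZero-zero {x} x≈0 with x ≟ 0#
  ... | yes _   = refl
  ... | no  x≉0 = contradiction x≈0 x≉0

  ifZero-nonzero : ∀ {x a b} → ¬ x ≈ 0# → ifZero x a b ≈ b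
  ifZero-nonzero {x} x≉0 with x ≟ 0#
  ... | yes x≈0 = contradiction x≈0 x≉0
  ... | no  _   = refl

  ifZero-cong : ∀ {x y a b d} → x ≈ y → b ≈ d → ifZero x a b ≈ ifZero y a d
  ifZero-cong {x} x≈y b≈d with x ≟ 0#
  ... | yes x≈0 = sym (ifZero-zero (trans (sym x≈y) x≈0))
  ... | no  x≉0 = trans b≈d (sym (ifZero-nonzero (x≉0 ∘ trans x≈y)))

  private
    product-nonzero : ∀ {j} (t : Fin j → Carrier) → (∀ i → ¬ t i ≈ 0#) → ¬ MonoidSum.sum *-monoid t ≈ 0#
    product-nonzero {zero}  t t≉0 1≈0 = 1≉0 1≈0
    product-nonzero {suc j} t t≉0 tt≈0 with *-zero-divisor _ _ tt≈0
    ... | inj₁ t₀≈0 = t≉0 zero t₀≈0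
    ... | inj₂ ts≈0 = product-nonzero (t ∘ suc) (t≉0 ∘ suc) ts≈0

  -- Multiplication by x ≉ 0 permutes the nonzero elements, hence preserves their product.
  x^N≈x : ∀ x → x ^ᴷ N ≈ x
  x^N≈x x with x ≟ 0#
  ... | yes x≈0 = trans (^-congˡ N x≈0) (trans (0^≈0 N {{ℕ.m^n≢0 q (suc m)}}) (sym x≈0))
  ... | no  x≉0 = begin
    x ^ᴷ N                                               ≈⟨ MonoidSum.sum-replicate *-monoid N ⟨
    *Total.total (const x)                               ≈⟨ *Total.total-cong split ⟩
    *Total.total (λ z → ifZero z 1# x * ifZero z x 1#)
      ≈⟨ *Total.total-∙ (λ z → ifZero z 1# x) (λ z → ifZero z x 1#) ⟩
    *Total.total (λ z → ifZero z 1# x) * *Total.total (λ z → ifZero z x 1#)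
      ≈⟨ *-cong all-but-one (trans (*Total.total-single (λ y≈z → ifZero-cong y≈z refl) 0# (λ y → ifZero-nonzero))
                                   (ifZero-zero refl)) ⟩
    1# * x                                               ≈⟨ *-identityˡ x ⟩
    x                                                    ∎
    where
    -- The constant family `x` is `x` off zero times `x` at zero, so x ^ N becomes x ^ (N - 1) times
    -- x; `all-but-one` evaluates the first factor.
    split : ∀ z → x ≈ ifZero z 1# x * ifZero z x 1#
    split z with z ≟ 0#
    ... | yes _ = sym (*-identityˡ x)
    ... | no  _ = sym (*-identityʳ x)

    units : Carrier → Carrier
    units z = ifZero z 1# z

    units≉0 : ∀ z → ¬ units z ≈ 0#
    units≉0 z with z ≟ 0#
    ... | yes _   = 1≉0
    ... | no  z≉0 = z≉0

    units-* : ∀ z → units (z * x) ≈ units z * ifZero z 1# x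
    units-* z with z ≟ 0#
    ... | yes z≈0 = trans (ifZero-zero (trans (*-congʳ z≈0) (zeroˡ x))) (sym (*-identityˡ 1#))
    ... | no  z≉0 = ifZero-nonzero ([ z≉0 , x≉0 ]′ ∘ *-zero-divisor z x)

    all-but-one : *Total.total (λ z → ifZero z 1# x) ≈ 1#
    all-but-one = sym (*-cancelˡ (product-nonzero (units ∘ from) (units≉0 ∘ from)) (begin
      *Total.total units * 1#              ≈⟨ *-identityʳ _ ⟩
      *Total.total units
        ≈⟨ *Total.total-permute (scaling x (inv x) (inv-inverse x≉0)) {units} (λ y≈z → ifZero-cong y≈z y≈z) ⟩
      *Total.total (λ z → units (z * x))   ≈⟨ *Total.total-cong units-* ⟩
      *Total.total (λ z → units z * ifZero z 1# x) ≈⟨ *Total.total-∙ units (λ z → ifZero z 1# x) ⟩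
      *Total.total units * *Total.total (λ z → ifZero z 1# x) ∎))

  Fq? : Decidable InFq
  Fq? x = x ^ᴷ q ≟ x

  Fq-resp : InFq Respects _≈_
  Fq-resp x≈y x∈ = trans (^-congˡ q (sym x≈y)) (trans x∈ x≈y)

  Fq-0 : InFq 0#
  Fq-0 = 0^≈0 q

  Fq-1 : InFq 1#
  Fq-1 = 1^≈1 q

  Fq-+ : ∀ {x y} → InFq x → InFq y → InFq (x + y)
  Fq-+ x∈ y∈ = trans (additive-q _ _) (+-cong x∈ y∈)

  Fq-neg : ∀ {x} → InFq x → InFq (- x)
  Fq-neg {x} x∈ = +-cancelʳ x _ _ (begin
    (- x) ^ᴷ q + x        ≈⟨ +-congˡ x∈ ⟨
    (- x) ^ᴷ q + x ^ᴷ q   ≈⟨ additive-q (- x) x ⟨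
    (- x + x) ^ᴷ q        ≈⟨ ^-congˡ q (-‿inverseˡ x) ⟩
    0# ^ᴷ q               ≈⟨ Fq-0 ⟩
    0#                    ≈⟨ -‿inverseˡ x ⟨
    - x + x               ∎)

  Fq-- : ∀ {x y} → InFq x → InFq y → InFq (x - y)
  Fq-- x∈ y∈ = Fq-+ x∈ (Fq-neg y∈)

  Fq-* : ∀ {x y} → InFq x → InFq y → InFq (x * y)
  Fq-* x∈ y∈ = trans (^-distrib-* _ _ q) (*-cong x∈ y∈)

  -- As x ^ q = x, the power y ^ q is again an inverse of x, and inverses are unique.
  Fq-inv : ∀ {x y} → y * x ≈ 1# → InFq x → InFq y
  Fq-inv {x} {y} yx≈1 x∈ = sym (trans (sym (inv-unique yx≈1)) (inv-unique (begin
    y ^ᴷ q * x        ≈⟨ *-congˡ x∈ ⟨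
    y ^ᴷ q * x ^ᴷ q   ≈⟨ ^-distrib-* y x q ⟨
    (y * x) ^ᴷ q      ≈⟨ ^-congˡ q yx≈1 ⟩
    1# ^ᴷ q           ≈⟨ Fq-1 ⟩
    1#                ∎)))

  Fq-power : ∀ {x} → InFq x → ∀ i → x ^ᴷ (q ℕ.^ i) ≈ x
  Fq-power {x} x∈ zero    = *-identityʳ x
  Fq-power {x} x∈ (suc i) = trans (sym (^-assocʳ x q (q ℕ.^ i)))
    (trans (^-congˡ (q ℕ.^ i) x∈) (Fq-power x∈ i))

  -- The q-th power shifts the summands of the trace cyclically, since x ^ N = x.
  Tr-Fq : ∀ x → InFq (Tr x)
  Tr-Fq x = begin
    Tr x ^ᴷ q                             ≈⟨ sum-^ q additive-q {suc m} (λ i → x ^ᴷ (q ℕ.^ toℕ i)) ⟩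
    +Sum.sum {suc m} (λ i → (x ^ᴷ (q ℕ.^ toℕ i)) ^ᴷ q)   ≈⟨ +Sum.sum-cong-≋ {suc m} (λ i → shift (toℕ i)) ⟩
    +Sum.sum {suc m} (λ i → u (suc (toℕ i)))             ≈⟨ sum-last +-commutativeMonoid m (u ∘ suc) ⟩
    +Sum.sum {m} (λ i → u (suc (toℕ i))) + u (suc m)     ≈⟨ +-congˡ (trans (x^N≈x x) (sym (*-identityʳ x))) ⟩
    +Sum.sum {m} (λ i → u (suc (toℕ i))) + u 0           ≈⟨ +-comm _ _ ⟩
    Tr x                                  ∎
    where
    u : ℕ → Carrier
    u i = x ^ᴷ (q ℕ.^ i)
    shift : ∀ i → u i ^ᴷ q ≈ u (suc i)
    shift i = trans (^-assocʳ x (q ℕ.^ i) q) (reflexive (≡.cong (x ^ᴷ_) (ℕ.*-comm (q ℕ.^ i) q)))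

  Tr-+ : ∀ x y → Tr (x + y) ≈ Tr x + Tr y
  Tr-+ x y = trans
    (+Sum.sum-cong-≋ {suc m} λ i → additive-^ q additive-q (toℕ i) x y)
    (+Sum.∑-distrib-+ {suc m} (λ i → x ^ᴷ (q ℕ.^ toℕ i)) (λ i → y ^ᴷ (q ℕ.^ toℕ i)))

  Tr-* : ∀ a x → InFq a → Tr (a * x) ≈ a * Tr x
  Tr-* a x a∈ = trans
    (+Sum.sum-cong-≋ {suc m} λ i → trans (^-distrib-* a x (q ℕ.^ toℕ i)) (*-congʳ (Fq-power a∈ (toℕ i))))
    (sym (+Sum.*-distribˡ-sum {suc m} a (λ i → x ^ᴷ (q ℕ.^ toℕ i))))

  frobenius-poly : ∀ {d} → 1 ℕ.< d → IsPolynomial d 1# (λ x → x ^ᴷ d - x)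
  frobenius-poly {d} 1<d = poly-cong {d = d} (trans (+-congˡ -0#≈0#) (+-identityʳ 1#)) (λ x → refl)
    (poly-+ d (poly-power d) (poly-neg d (poly-cong {d = d} refl *-identityʳ (poly-< (ℕ.≤⇒≤′ 1<d) (poly-power 1)))))

  -- Serves twice: d = q bounds `#Fq`, and in `inverse-power-sum-zero` it yields an element that the
  -- `e`-th power moves.
  fixed-bound : ∀ {d} → 1 ℕ.< d → count (λ x → x ^ᴷ d ≟ x) ℕ.≤ d
  fixed-bound {d} 1<d = ℕ.≤-trans
    (count-mono (λ x → x ^ᴷ d ≟ x) (λ x → x ^ᴷ d - x ≟ 0#) (λ {x} → x≈y⇒x∙y⁻¹≈ε))
    (root-bound d (frobenius-poly 1<d) 1≉0)

  trace-poly : ∀ j → IsPolynomial (q ℕ.^ j) 1# (λ x → +Sum.sum {suc j} (λ i → x ^ᴷ (q ℕ.^ toℕ i)))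
  trace-poly zero    = poly-cong {d = 1} refl (λ x → sym (+-identityʳ _)) (poly-power 1)
  trace-poly (suc j) = poly-cong {d = q ℕ.^ suc j} (+-identityˡ 1#)
    (λ x → sym (sum-last +-commutativeMonoid (suc j) (λ i → x ^ᴷ (q ℕ.^ i))))
    (poly-+ (q ℕ.^ suc j)
      (poly-< (ℕ.≤⇒≤′ (ℕ.^-monoʳ-< q 1<q (ℕ.n<1+n j))) (trace-poly j)) (poly-power (q ℕ.^ suc j)))

  -- Tr x - a is monic of degree q ^ m: the constant sits in degree 0 < q ^ m and leaves the top
  -- coefficient alone.
  Tr-fibre-bound : ∀ a → count (λ x → Tr x ≟ a) ℕ.≤ q ℕ.^ m
  Tr-fibre-bound a = ℕ.≤-trans
    (count-mono (λ x → Tr x ≟ a) (λ x → Tr x - a ≟ 0#) (λ {x} → x≈y⇒x∙y⁻¹≈ε))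
    (root-bound (q ℕ.^ m) (poly-+ (q ℕ.^ m) (trace-poly m)
        (poly-< {d = 0} {u = - a} (ℕ.≤⇒≤′ (ℕ.m^n>0 q m)) (λ x → refl)))
      (1≉0 ∘ trans (sym (+-identityʳ 1#))))

-- Fibres over F_q and the size of F_q

module Fibres
  {c ℓ₁ ℓ₂} (q m : ℕ) (q-primePower : IsPrimePower q)
  (K : HeytingField c ℓ₁ ℓ₂) (enum : HasSize K (q ℕ.^ suc m)) where

  open TraceTheory q m q-primePower K enum public
  private module ℕSumDistrib = SemiringSum ℕ.+-*-semiring

  #Fq : ℕ
  #Fq = count Fq?

  fibre : (Carrier → Carrier) → Carrier → ℕ
  fibre h a = count λ x → h x ≟ a

  fibre-mono : ∀ h {a b} → a ≈ b → fibre h a ℕ.≤ fibre h b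
  fibre-mono h {a} {b} a≈b = count-mono (λ x → h x ≟ a) (λ x → h x ≟ b) (λ hx≈a → trans hx≈a a≈b)

  -- Double counting of the pairs (a, x) with h x = a: each x lies in exactly one fibre.
  fibres-total : ∀ h → #Total.total (fibre h) ≡ N
  fibres-total h = ≡.trans (ℕSum.∑-comm {N} {N} (λ i j → [ h (from j) ≟ from i ]))
    (≡.trans (#Total.total-cong λ x → count-one (λ a → h x ≟ a) (λ a≈b hx≈a → trans hx≈a a≈b)
               (h x) refl (λ a hx≈a → sym hx≈a))
             #total-one)

  scaled-total : ∀ B → #Total.total (λ a → [ Fq? a ] ℕ.* B) ≡ #Fq ℕ.* B
  scaled-total B = ≡.sym (ℕSumDistrib.*-distribʳ-sum {N} B (λ i → [ Fq? (from i) ]))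

  module _ {h : Carrier → Carrier} (h-Fq : ∀ x → InFq (h x)) where

    -- A sum over F_q is encoded as a sum over `K` weighted by `[ Fq? a ]`. Where the weight
    -- vanishes the fibre is empty, since `h` takes values in F_q.
    fibre-≤-scaled : ∀ {B} → (∀ a → InFq a → fibre h a ℕ.≤ B) → ∀ a → fibre h a ℕ.≤ [ Fq? a ] ℕ.* B
    fibre-≤-scaled {B} bound a with Fq? a
    ... | yes a∈ = ℕ.≤-trans (bound a a∈) (ℕ.m≤m+n B 0)
    ... | no  a∉ = ℕ.≤-reflexive (count-none (λ x → h x ≟ a) λ x hx≈a → a∉ (Fq-resp hx≈a (h-Fq x)))

    fibres-upper : ∀ {B} → (∀ a → InFq a → fibre h a ℕ.≤ B) → N ℕ.≤ #Fq ℕ.* B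
    fibres-upper {B} bound = ≡.subst₂ ℕ._≤_ (fibres-total h) (scaled-total B)
      (sum-mono (fibre-≤-scaled bound ∘ from))

    -- The elements of `K` fill the fibres to their joint capacity, so no single fibre falls short.
    fibres-tight : ∀ {B} → (∀ a → InFq a → fibre h a ℕ.≤ B) → #Fq ℕ.* B ℕ.≤ N →
                   ∀ a → InFq a → B ℕ.≤ fibre h a
    fibres-tight {B} bound total≤ a a∈ = begin
      B                          ≡⟨ ℕ.*-identityˡ B ⟨
      1 ℕ.* B                    ≡⟨ ≡.cong (ℕ._* B) ([]-yes (Fq? a′) (Fq-resp (sym a′≈a) a∈)) ⟨
      [ Fq? a′ ] ℕ.* B           ≡⟨ sum-tight (fibre-≤-scaled bound ∘ from)
                                      (≡.subst₂ ℕ._≤_ (≡.sym (scaled-total B)) (≡.sym (fibres-total h)) total≤)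
                                      (to a) ⟨
      fibre h a′                 ≤⟨ fibre-mono h a′≈a ⟩
      fibre h a                  ∎
      where
      open ℕ.≤-Reasoning
      a′ = from (to a)
      a′≈a = strictlyInverseʳ a

  fibres-lower : ∀ h {B} → (∀ a → InFq a → B ℕ.≤ fibre h a) → #Fq ℕ.* B ℕ.≤ N
  fibres-lower h {B} bound = ≡.subst₂ ℕ._≤_ (scaled-total B) (fibres-total h)
    (sum-mono (λ i → scaled-≤ (from i)))
    where
    scaled-≤ : ∀ a → [ Fq? a ] ℕ.* B ℕ.≤ fibre h a
    scaled-≤ a with Fq? a
    ... | yes a∈ = ℕ.≤-trans (ℕ.≤-reflexive (ℕ.*-identityˡ B)) (bound a a∈)
    ... | no  _  = z≤n

  -- At most `q`, as x ^ q - x has no more roots; at least `q`, as the trace distributes q * q ^ m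
  -- elements over F_q with at most q ^ m in each fibre.
  #Fq≡q : #Fq ≡ q
  #Fq≡q = ℕ.≤-antisym (fixed-bound 1<q)
    (ℕ.*-cancelʳ-≤ q #Fq (q ℕ.^ m) {{ℕ.m^n≢0 q m}}
      (fibres-upper Tr-Fq λ a _ → Tr-fibre-bound a))

-- Linear maps into F_q and trace duality

module Linear
  {c ℓ₁ ℓ₂} (q m : ℕ) (q-primePower : IsPrimePower q)
  (K : HeytingField c ℓ₁ ℓ₂) (enum : HasSize K (q ℕ.^ suc m)) where

  open Fibres q m q-primePower K enum public
  open ≈-Reasoning
  open Mult semiring using () renaming (_×_ to _·_)

  linear-cong : ∀ {g h} → (∀ x → g x ≈ h x) → IsFqLinear g → IsFqLinear h
  linear-cong g≈h (g-+ , g-*) =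
      (λ x y → trans (sym (g≈h (x + y))) (trans (g-+ x y) (+-cong (g≈h x) (g≈h y))))
    , (λ a x a∈ → trans (sym (g≈h (a * x))) (trans (g-* a x a∈) (*-congˡ (g≈h x))))

  module LinearMap {g : Carrier → Carrier} (g-cong : Congruent _≈_ _≈_ g) (linear : IsFqLinear g) where
    g-+ = proj₁ linear
    g-* = proj₂ linear

    g-*ʳ : ∀ x {a} → InFq a → g (x * a) ≈ a * g x
    g-*ʳ x {a} a∈ = trans (g-cong (*-comm x a)) (g-* a x a∈)

    g-0 : g 0# ≈ 0#
    g-0 = trans (g-cong (sym (zeroˡ 0#))) (trans (g-* 0# 0# Fq-0) (zeroˡ _))

    g-neg : ∀ x → g (- x) ≈ - g x
    g-neg x = begin
      g (- x)        ≈⟨ g-cong (solve 1 (λ x → :- x := x :* :- con (+ 1)) refl x) ⟩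
      g (x * - 1#)   ≈⟨ g-*ʳ x (Fq-neg Fq-1) ⟩
      - 1# * g x     ≈⟨ solve 1 (λ y → :- con (+ 1) :* y := :- y) refl (g x) ⟩
      - g x          ∎

    g-- : ∀ x y → g (x - y) ≈ g x - g y
    g-- x y = trans (g-+ x (- y)) (+-congˡ (g-neg y))

    g-sum : ∀ {k} (t : Fin k → Carrier) → g (+Sum.sum t) ≈ +Sum.sum (g ∘ t)
    g-sum {zero}  t = g-0
    g-sum {suc k} t = trans (g-+ _ _) (+-congˡ (g-sum (t ∘ suc)))

    g-total : ∀ t → g (total t) ≈ total (g ∘ t)
    g-total t = g-sum (t ∘ from)

  inv-* : ∀ z {w} → ¬ w ≈ 0# → inv (z * w) ≈ inv z * inv w
  inv-* z {w} w≉0 with z ≟ 0#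
  ... | yes z≈0 = trans (inv-zero (trans (*-congʳ z≈0) (zeroˡ w))) (sym (zeroˡ _))
  ... | no  z≉0 = inv-unique (begin
    i * inv w * (z * w)
      ≈⟨ solve 4 (λ i j z w → i :* j :* (z :* w) := (i :* z) :* (j :* w)) refl i (inv w) z w ⟩
    i * z * (inv w * w)    ≈⟨ *-cong (proj₂ (invertible z z≉0)) (inv-inverse w≉0) ⟩
    1# * 1#                ≈⟨ *-identityˡ 1# ⟩
    1#                     ∎)
    where i = proj₁ (invertible z z≉0)

  quotient-involutive : ∀ {x} → ¬ x ≈ 0# → ∀ z → x * inv (x * inv z) ≈ z
  quotient-involutive {x} x≉0 z with z ≟ 0#
  ... | yes z≈0 = trans (*-congˡ (inv-zero (zeroʳ x))) (trans (zeroʳ x) (sym z≈0))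
  ... | no  z≉0 = begin
    x * inv (x * i)        ≈⟨ *-congˡ (inv-unique (begin
      z * inv x * (x * i)
        ≈⟨ solve 4 (λ z j x i → z :* j :* (x :* i) := (i :* z) :* (j :* x)) refl z (inv x) x i ⟩
      i * z * (inv x * x)    ≈⟨ *-cong (proj₂ (invertible z z≉0)) (inv-inverse x≉0) ⟩
      1# * 1#                ≈⟨ *-identityˡ 1# ⟩
      1#                     ∎)) ⟩
    x * (z * inv x)        ≈⟨ solve 3 (λ x z j → x :* (z :* j) := z :* (j :* x)) refl x z (inv x) ⟩
    z * (inv x * x)        ≈⟨ *-congˡ (inv-inverse x≉0) ⟩
    z * 1#                 ≈⟨ *-identityʳ z ⟩
    z                      ∎
    where i = proj₁ (invertible z z≉0)

  -- For e ≥ 1 this is the sum of z ^ (e - 1) over nonzero z, in the shape in which it occurs in ∑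
  -- Tr(z) / z.
  inverse-power-sum : ℕ → Carrier
  inverse-power-sum e = total λ z → inv z * z ^ᴷ e

  -- Substituting z w for z multiplies the sum by w ^ e / w, which is not 1 for some w.
  inverse-power-sum-zero : ∀ {e} → 1 ℕ.< e → e ℕ.< N → inverse-power-sum e ≈ 0#
  inverse-power-sum-zero {e} 1<e e<N with find (λ w → ¬? (w ^ᴷ e ≟ w))
    (λ w≈v w^e≉w v^e≈v → w^e≉w (trans (^-congˡ e w≈v) (trans v^e≈v (sym w≈v))))
  -- If no such w existed, x ^ e - x would vanish at all N > e elements.
  ... | no  none = contradiction (fixed-bound 1<e) (ℕ.<⇒≱ (≡.subst (e ℕ.<_)
          (≡.sym (count-all (λ w → w ^ᴷ e ≟ w) fixed)) e<N))
    where
    fixed : ∀ w → w ^ᴷ e ≈ w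
    fixed w = decidable-stable (w ^ᴷ e ≟ w) λ w^e≉w → none (w , w^e≉w)
  ... | yes (w , w^e≉w) with inverse-power-sum e ≟ 0#
  ...   | yes S≈0 = S≈0
  ...   | no  S≉0 = contradiction (begin
    w ^ᴷ e                   ≈⟨ *-identityˡ _ ⟨
    1# * w ^ᴷ e              ≈⟨ *-congʳ (trans (*-comm _ _) (inv-inverse w≉0)) ⟨
    w * inv w * w ^ᴷ e       ≈⟨ *-assoc _ _ _ ⟩
    w * (inv w * w ^ᴷ e)     ≈⟨ *-congˡ (*-cancelˡ S≉0 (trans scaled (sym (*-identityʳ _)))) ⟩
    w * 1#                   ≈⟨ *-identityʳ w ⟩
    w                        ∎) w^e≉w
    where
    w≉0 : ¬ w ≈ 0#
    w≉0 w≈0 = w^e≉w (trans (^-congˡ e w≈0)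
      (trans (0^≈0 e {{ℕ.>-nonZero (ℕ.<-trans (s≤s z≤n) 1<e)}}) (sym w≈0)))
    S = inverse-power-sum e
    scaled : S * (inv w * w ^ᴷ e) ≈ S
    scaled = begin
      S * (inv w * w ^ᴷ e)
        ≈⟨ +Sum.*-distribʳ-sum {N} (inv w * w ^ᴷ e) (λ i → inv (from i) * from i ^ᴷ e) ⟩
      total (λ z → inv z * z ^ᴷ e * (inv w * w ^ᴷ e))    ≈⟨ +Total.total-cong (λ z → begin
        inv (z * w) * (z * w) ^ᴷ e                         ≈⟨ *-cong (inv-* z w≉0) (^-distrib-* z w e) ⟩
        inv z * inv w * (z ^ᴷ e * w ^ᴷ e)
          ≈⟨ solve 4 (λ i j a b → i :* j :* (a :* b) := i :* a :* (j :* b)) refl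
                                                                (inv z) (inv w) (z ^ᴷ e) (w ^ᴷ e) ⟩
        inv z * z ^ᴷ e * (inv w * w ^ᴷ e)                  ∎) ⟨
      total (λ z → inv (z * w) * (z * w) ^ᴷ e)
        ≈⟨ +Total.total-permute (scaling w (inv w) (inv-inverse w≉0)) {λ z → inv z * z ^ᴷ e}
                                                              (λ y≈z → *-cong (inv-cong y≈z) (^-congˡ e y≈z)) ⟨
      S                                                  ∎

  -- Every nonzero z contributes 1. Adding the missing 1 at zero completes the sum to N times 1,
  -- which is zero.
  inverse-power-sum-one : inverse-power-sum 1 ≈ - 1#
  inverse-power-sum-one = +-cancelʳ 1# _ _ (begin
    inverse-power-sum 1 + 1#                             ≈⟨ +-congˡ (ifZero-zero refl) ⟨
    inverse-power-sum 1 + ifZero 0# 1# 0#                ≈⟨ +-congˡ (+Total.total-single {λ z → ifZero z 1# 0#}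
                                                              (λ y≈z → ifZero-cong y≈z refl) 0# (λ y → ifZero-nonzero)) ⟨
    inverse-power-sum 1 + total (λ z → ifZero z 1# 0#)
      ≈⟨ +Total.total-∙ (λ z → inv z * z ^ᴷ 1) (λ z → ifZero z 1# 0#) ⟨
    total (λ z → inv z * z ^ᴷ 1 + ifZero z 1# 0#)        ≈⟨ +Total.total-cong one ⟩
    total (const 1#)                                     ≈⟨ +Sum.sum-replicate N ⟩
    N · 1#                                               ≈⟨ N×1≈0 ⟩
    0#                                                   ≈⟨ -‿inverseˡ 1# ⟨
    - 1# + 1#                                            ∎)
    where
    one : ∀ z → inv z * z ^ᴷ 1 + ifZero z 1# 0# ≈ 1#
    one z with z ≟ 0#
    ... | yes z≈0 = trans (+-congʳ (zeroˡ _)) (+-identityˡ 1#)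
    ... | no  z≉0 = trans (+-identityʳ _) (trans (*-congˡ (*-identityʳ z)) (proj₂ (invertible z z≉0)))

  -- After exchanging the sums, the exponents q ^ i with i ≥ 1 satisfy 1 < q ^ i < N and contribute
  -- nothing; i = 0 leaves `inverse-power-sum 1`.
  ∑Tr/z≈-1 : total (λ z → inv z * Tr z) ≈ - 1#
  ∑Tr/z≈-1 = begin
    total (λ z → inv z * Tr z)
      ≈⟨ +Total.total-cong (λ z → +Sum.*-distribˡ-sum {suc m} (inv z) (λ i → z ^ᴷ (q ℕ.^ toℕ i))) ⟩
    total (λ z → +Sum.sum {suc m} λ i → inv z * z ^ᴷ (q ℕ.^ toℕ i))
      ≈⟨ +Sum.∑-comm {N} {suc m} (λ j i → inv (from j) * from j ^ᴷ (q ℕ.^ toℕ i)) ⟩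
    +Sum.sum {suc m} (λ i → inverse-power-sum (q ℕ.^ toℕ i))
      ≈⟨ sum-single +-commutativeMonoid {suc m} (λ i → inverse-power-sum (q ℕ.^ toℕ i)) zero higher ⟩
    inverse-power-sum 1       ≈⟨ inverse-power-sum-one ⟩
    - 1#                      ∎
    where
    higher : ∀ i → i ≢ zero → inverse-power-sum (q ℕ.^ toℕ i) ≈ 0#
    higher zero    0≢0 = contradiction ≡.refl 0≢0
    higher (suc i) _   = inverse-power-sum-zero
      (ℕ.^-monoʳ-< q 1<q {0} {suc (toℕ i)} (s≤s z≤n)) (ℕ.^-monoʳ-< q 1<q (s≤s (toℕ<n i)))

  -- For linear f with values in F_q and u′ = ∑ f(y) / y, the substitution y = x / z gives
  -- Tr (u′ x) = ∑ f(y) Tr (x / y) = ∑ f(x / z) Tr z = f (x ∑ Tr(z) / z) = f (- x).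
  module Duality {f : Carrier → Carrier} (f-cong : Congruent _≈_ _≈_ f) (f-Fq : ∀ x → InFq (f x))
    (f-linear : IsFqLinear f) where

    private
      module f = LinearMap f-cong f-linear
      module Tr = LinearMap Tr-cong (Tr-+ , Tr-*)

    substitution : ∀ x → ¬ x ≈ 0# → Inverse setoid setoid
    substitution x x≉0 = record
      { to = λ z → x * inv z
      ; from = λ z → x * inv z
      ; to-cong = *-congˡ ∘ inv-cong
      ; from-cong = *-congˡ ∘ inv-cong
      ; inverse = (λ z≈ → trans (*-congˡ (inv-cong z≈)) (quotient-involutive x≉0 _))
                , (λ z≈ → trans (*-congˡ (inv-cong z≈)) (quotient-involutive x≉0 _))
      }

    u′ : Carrier
    u′ = total λ y → f y * inv y

    Tr-u′* : ∀ x → Tr (u′ * x) ≈ f (- x)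
    Tr-u′* x with x ≟ 0#
    ... | yes x≈0 = trans (Tr-cong (trans (*-congˡ x≈0) (zeroʳ u′)))
                      (trans Tr.g-0 (trans (sym f.g-0) (f-cong (sym (trans (-‿cong x≈0) -0#≈0#)))))
    ... | no  x≉0 = begin
      Tr (u′ * x)
        ≈⟨ Tr-cong (+Sum.*-distribʳ-sum {N} x (λ i → f (from i) * inv (from i))) ⟩
      Tr (total λ y → f y * inv y * x)                   ≈⟨ Tr.g-total (λ y → f y * inv y * x) ⟩
      -- Each map is linear over the values of the other: `f y` lies in F_q and leaves `Tr` here,
      -- and after the substitution `Tr z` enters `f` for the same reason.
      total (λ y → Tr (f y * inv y * x))                 ≈⟨ +Total.total-cong (λ y →
        trans (Tr-cong (solve 3 (λ a i x → a :* i :* x := a :* (x :* i)) refl (f y) (inv y) x)) (Tr-* (f y) _ (f-Fq y))) ⟩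
      total (λ y → f y * Tr (x * inv y))
        ≈⟨ +Total.total-permute (substitution x x≉0) {λ y → f y * Tr (x * inv y)}
        (λ y≈z → *-cong (f-cong y≈z) (Tr-cong (*-congˡ (inv-cong y≈z)))) ⟩
      total (λ z → f (x * inv z) * Tr (x * inv (x * inv z)))
        ≈⟨ +Total.total-cong (λ z → trans (*-congˡ (Tr-cong (quotient-involutive x≉0 z))) (trans (*-comm _ _) (sym (f.g-* (Tr z) (x * inv z) (Tr-Fq z))))) ⟩
      total (λ z → f (Tr z * (x * inv z)))               ≈⟨ f.g-total (λ z → Tr z * (x * inv z)) ⟨
      f (total λ z → Tr z * (x * inv z))                 ≈⟨ f-cong (+Total.total-cong λ z →
        solve 3 (λ t x i → t :* (x :* i) := x :* (i :* t)) refl (Tr z) x (inv z)) ⟩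
      f (total λ z → x * (inv z * Tr z))
        ≈⟨ f-cong (+Sum.*-distribˡ-sum {N} x (λ i → inv (from i) * Tr (from i))) ⟨
      f (x * total (λ z → inv z * Tr z))                 ≈⟨ f-cong (*-congˡ ∑Tr/z≈-1) ⟩
      f (x * - 1#)
        ≈⟨ f-cong (solve 1 (λ x → x :* :- con (+ 1) := :- x) refl x) ⟩
      f (- x)                                            ∎

    representation : ∃ λ u → ∀ x → f x ≈ Tr (u * x)
    representation = - u′ , λ x → begin
      f x              ≈⟨ f-cong (-‿involutive x) ⟨
      f (- - x)        ≈⟨ Tr-u′* (- x) ⟨
      Tr (u′ * - x)    ≈⟨ Tr-cong (solve 2 (λ u x → u :* :- x := :- u :* x) refl u′ x) ⟩
      Tr (- u′ * x)    ∎

-- Bad values as directions of the graph of f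

module Directions
  {c ℓ₁ ℓ₂} (q m : ℕ) (q-primePower : IsPrimePower q)
  (K : HeytingField c ℓ₁ ℓ₂) (enum : HasSize K (q ℕ.^ suc m))
  (H : FiniteField.Polynomial q (suc m) K enum)
  (nonconstant : ¬ FiniteField.IsConstant q (suc m) K enum (FiniteField.TrOf q (suc m) K enum H)) where

  open Linear q m q-primePower K enum public
  open ≈-Reasoning

  f : Carrier → Carrier
  f = TrOf H

  f-cong : Congruent _≈_ _≈_ f
  f-cong = Tr-cong ∘ eval-cong H

  f-Fq : ∀ x → InFq (f x)
  f-Fq x = Tr-Fq (eval H x)

  -- Search turns the negative hypothesis `nonconstant` into a witness; it supplies the base point y
  -- off a given fibre.
  f-varies : ∀ a → ∃ λ y → ¬ f y ≈ a
  f-varies a with find (λ y → ¬? (f y ≟ a)) (λ y≈z fy≉a fz≈a → fy≉a (trans (f-cong y≈z) fz≈a))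
  ... | yes found = found
  ... | no  none  = contradiction (a , constant) nonconstant
    where
    constant : ∀ y → f y ≈ a
    constant y = decidable-stable (f y ≟ a) λ fy≉a → none (y , fy≉a)

  Bad : Carrier → Set (c ⊔ ℓ₁)
  Bad γ = ¬ P H γ

  Bad? : Decidable Bad
  Bad? γ = ¬? (P? H γ)

  #Bad : ℕ
  #Bad = count Bad?

  P-resp : P H Respects _≈_
  P-resp {γ} {δ} γ≈δ (inj , surj) =
      (λ {x} {y} e → inj (trans (step x) (trans e (sym (step y)))))
    , λ z → proj₁ (surj z) , λ {x} x≈ → trans (sym (step x)) (proj₂ (surj z) x≈)
    where
    step : ∀ x → x + γ * f x ≈ x + δ * f x
    step x = +-congˡ (*-congʳ γ≈δ)

  Bad-resp : Bad Respects _≈_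
  Bad-resp γ≈δ bad = bad ∘ P-resp (sym γ≈δ)

  #P+#Bad : ∣P∣ H ℕ.+ #Bad ≡ N
  #P+#Bad = ≡.trans (≡.cong (ℕ._+ #Bad) (length-filter-tabulate (P? H) from)) (count-complement (P? H))

  -- For γ = (x - y) / (f y - f x), the negated inverse slope of the secant through x and y, the two
  -- points have the same image under x ↦ x + γ f(x), yet `f` separates them.
  slope-bad : ∀ {x y t} → t * (f y - f x) ≈ 1# → Bad ((x - y) * t)
  slope-bad {x} {y} {t} t≈ (inj , _) = 1≉0 (begin
    1#                 ≈⟨ t≈ ⟨
    t * (f y - f x)    ≈⟨ *-congˡ (x≈y⇒x∙y⁻¹≈ε (f-cong (sym (inj collision)))) ⟩
    t * 0#             ≈⟨ zeroʳ t ⟩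
    0#                 ∎)
    where
    collision : x + (x - y) * t * f x ≈ y + (x - y) * t * f y
    collision = begin
      x + (x - y) * t * f x                                  ≈⟨ solve 4 (λ x y t fx → x :+ (x :- y) :* t :* fx
                                                                   := (y :+ (x :- y) :* t :* fx) :+ (x :- y) :* con (+ 1))
                                                                 refl x y t (f x) ⟩
      (y + (x - y) * t * f x) + (x - y) * 1#                 ≈⟨ +-congˡ (*-congˡ t≈) ⟨
      (y + (x - y) * t * f x) + (x - y) * (t * (f y - f x))  ≈⟨ solve 5 (λ x y t fx fy →
                                                                   (y :+ (x :- y) :* t :* fx) :+ (x :- y) :* (t :* (fy :- fx))
                                                                   := y :+ (x :- y) :* t :* fy)
                                                                 refl x y t (f x) (f y) ⟩
      y + (x - y) * t * f y                                  ∎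

  -‿≉0 : ∀ {x y} → ¬ x ≈ y → ¬ x - y ≈ 0#
  -‿≉0 x≉y = x≉y ∘ x∙y⁻¹≈ε⇒x≈y _ _

  -- x ↦ (x - y) / (f y - a) sends the fibre of f over a into the bad values.
  slope : ∀ y a → ¬ f y ≈ a → Inverse setoid setoid
  slope y a fy≉a = inverse (translation (- y))
    (scaling (inv (f y - a)) (f y - a) (trans (*-comm _ _) (inv-inverse (-‿≉0 fy≉a))))

  slope-fibre : ∀ y a (fy≉a : ¬ f y ≈ a) {x} → f x ≈ a → Bad (Inverse.to (slope y a fy≉a) x)
  slope-fibre y a fy≉a fx≈a =
    slope-bad (trans (*-congˡ (+-congˡ (-‿cong fx≈a))) (inv-inverse (-‿≉0 fy≉a)))

  fibre≤#Bad : ∀ a → fibre f a ℕ.≤ #Bad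
  fibre≤#Bad a with f-varies a
  ... | y , fy≉a = count-transport (λ x → f x ≟ a) Bad? Bad-resp (slope y a fy≉a) (slope-fibre y a fy≉a)

  q^m≤#Bad : q ℕ.^ m ℕ.≤ #Bad
  q^m≤#Bad = ℕ.*-cancelˡ-≤ q (≡.subst (λ s → N ℕ.≤ s ℕ.* #Bad) #Fq≡q
    (fibres-upper f-Fq λ a _ → fibre≤#Bad a))

  -- Equality in the bound forces affinity

  module Tight (#Bad≡ : #Bad ≡ q ℕ.^ m) where

    bad-shift : ∀ {γ a} → Bad γ → InFq a → ∀ y → f (y + γ * a) ≈ f y - a
    bad-shift {γ} {a} bad a∈ y with a ≟ 0#
    ... | yes a≈0 = begin
      f (y + γ * a)   ≈⟨ f-cong (trans (+-congˡ (trans (*-congˡ a≈0) (zeroʳ γ))) (+-identityʳ y)) ⟩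
      f y             ≈⟨ +-identityʳ (f y) ⟨
      f y + 0#        ≈⟨ +-congˡ (trans (-‿cong a≈0) -0#≈0#) ⟨
      f y - a         ∎
    ... | no  a≉0 = count-transport-tight (λ x → f x ≟ b) Bad?
      (λ x≈z fx≈b → trans (f-cong (sym x≈z)) fx≈b) Bad-resp
      (slope y b fy≉b) (slope-fibre y b fy≉b) #Bad≤ (Bad-resp (sym slope≈γ) bad)
      where
      -- Chosen so that the slope map at `y` divides by f y - b = a and thus carries y + γ a to γ.
      b = f y - a
      s≈a : f y - b ≈ a
      s≈a = solve 2 (λ fy a → fy :- (fy :- a) := a) refl (f y) a
      fy≉b : ¬ f y ≈ b
      fy≉b fy≈b = a≉0 (trans (sym s≈a) (x≈y⇒x∙y⁻¹≈ε fy≈b))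
      -- The `q` fibres over F_q have at most `#Bad` = q ^ m elements each and together exhaust `K`,
      -- so each attains that size.
      #Bad≤ : #Bad ℕ.≤ fibre f b
      #Bad≤ = fibres-tight f-Fq (λ a _ → fibre≤#Bad a)
        (ℕ.≤-reflexive (≡.cong₂ ℕ._*_ #Fq≡q #Bad≡)) b (Fq-- (f-Fq y) a∈)
      slope≈γ : ((y + γ * a) - y) * inv (f y - b) ≈ γ
      slope≈γ = begin
        ((y + γ * a) - y) * inv (f y - b)   ≈⟨ *-congˡ (inv-cong s≈a) ⟩
        ((y + γ * a) - y) * inv a
          ≈⟨ solve 4 (λ y γ a i → ((y :+ γ :* a) :- y) :* i := γ :* (i :* a)) refl y γ a (inv a) ⟩
        γ * (inv a * a)                     ≈⟨ *-congˡ (inv-inverse a≉0) ⟩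
        γ * 1#                              ≈⟨ *-identityʳ γ ⟩
        γ                                   ∎

    -- With the bad value γ = (x - y) / (f y - f x), the step b (x - y) equals γ times b (f y - f
    -- x). That multiplier lies in F_q, so `bad-shift` applies.
    difference-distinct : ∀ {x y} → ¬ f x ≈ f y → ∀ z b → InFq b →
                          f (z + b * (x - y)) ≈ f z + b * (f x - f y)
    difference-distinct {x} {y} fx≉fy z b b∈ = begin
      f (z + b * (x - y))                        ≈⟨ f-cong (+-congˡ (begin
        b * (x - y)                                ≈⟨ *-identityʳ _ ⟨
        b * (x - y) * 1#                           ≈⟨ *-congˡ i≈ ⟨
        b * (x - y) * (i * (f y - f x))
          ≈⟨ solve 4 (λ b d i e → b :* d :* (i :* e) := d :* i :* (b :* e))
                                                        refl b (x - y) i (f y - f x) ⟩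
        (x - y) * i * (b * (f y - f x))            ∎)) ⟩
      f (z + (x - y) * i * (b * (f y - f x)))
        ≈⟨ bad-shift (slope-bad i≈) (Fq-* b∈ (Fq-- (f-Fq y) (f-Fq x))) z ⟩
      f z - b * (f y - f x)
        ≈⟨ solve 4 (λ fz b fx fy → fz :- b :* (fy :- fx) := fz :+ b :* (fx :- fy))
                                                      refl (f z) b (f x) (f y) ⟩
      f z + b * (f x - f y)                      ∎
      where
      i = inv (f y - f x)
      i≈ : i * (f y - f x) ≈ 1#
      i≈ = inv-inverse (-‿≉0 (fx≉fy ∘ sym))

    bad-value : ∃ Bad
    bad-value with f-varies (f 0#)
    ... | y , fy≉f0 = _ , slope-bad {0#} {y} (inv-inverse (-‿≉0 fy≉f0))

    -- One identity for both halves of affinity: b = 1 and y = 0 give additivity of f - f(0), and y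
    -- = z = 0 give homogeneity.
    difference : ∀ x y z b → InFq b → f (z + b * (x - y)) ≈ f z + b * (f x - f y)
    difference x y z b b∈ with f x ≟ f y
    ... | no  fx≉fy = difference-distinct fx≉fy z b b∈
    -- Points with equal values determine no bad value. Moving x by a bad γ to x′ lowers its value
    -- by 1, which separates it from y; the extra shift by γ b lowers both sides by b and cancels.
    ... | yes fx≈fy = +-cancelʳ (- b) _ _ (begin
      f (z + b * (x - y)) - b                  ≈⟨ bad-shift bad b∈ (z + b * (x - y)) ⟨
      f (z + b * (x - y) + γ * b)              ≈⟨ f-cong (solve 5 (λ x y z b γ → z :+ b :* (x :- y) :+ γ :* b
                                                                   := z :+ b :* ((x :+ γ :* con (+ 1)) :- y)) refl x y z b γ) ⟩
      f (z + b * (x′ - y))                     ≈⟨ difference-distinct fx′≉fy z b b∈ ⟩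
      f z + b * (f x′ - f y)                   ≈⟨ +-congˡ (*-congˡ (+-congʳ fx′≈)) ⟩
      f z + b * ((f x - 1#) - f y)             ≈⟨ solve 4 (λ fx fy fz b → fz :+ b :* ((fx :- con (+ 1)) :- fy)
                                                            := fz :+ b :* (fx :- fy) :- b) refl (f x) (f y) (f z) b ⟩
      f z + b * (f x - f y) - b                ∎)
      where
      γ = proj₁ bad-value
      bad = proj₂ bad-value
      x′ = x + γ * 1#
      fx′≈ : f x′ ≈ f x - 1#
      fx′≈ = bad-shift bad Fq-1 x
      fx′≉fy : ¬ f x′ ≈ f y
      fx′≉fy fx′≈fy = 1≉0 (begin
        1#                     ≈⟨ solve 1 (λ fx → con (+ 1) := fx :- (fx :- con (+ 1))) refl (f x) ⟩
        f x - (f x - 1#)       ≈⟨ +-congˡ (-‿cong fx′≈) ⟨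
        f x - f x′             ≈⟨ x≈y⇒x∙y⁻¹≈ε (trans fx≈fy (sym fx′≈fy)) ⟩
        0#                     ∎)

    affine : IsFqAffine f
    affine = (λ x y → begin
        f (x + y) - f 0#
          ≈⟨ +-congʳ (f-cong (solve 2 (λ x y → x :+ y := x :+ con (+ 1) :* (y :- con (+ 0))) refl x y)) ⟩
        f (x + 1# * (y - 0#)) - f 0#        ≈⟨ +-congʳ (difference y 0# x 1# Fq-1) ⟩
        f x + 1# * (f y - f 0#) - f 0#
          ≈⟨ solve 3 (λ fx fy f0 → fx :+ con (+ 1) :* (fy :- f0) :- f0 := (fx :- f0) :+ (fy :- f0))
                                                 refl (f x) (f y) (f 0#) ⟩
        (f x - f 0#) + (f y - f 0#)         ∎)
      , λ a x a∈ → begin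
        f (a * x) - f 0#
          ≈⟨ +-congʳ (f-cong (solve 2 (λ a x → a :* x := con (+ 0) :+ a :* (x :- con (+ 0))) refl a x)) ⟩
        f (0# + a * (x - 0#)) - f 0#        ≈⟨ +-congʳ (difference x 0# 0# a a∈) ⟩
        f 0# + a * (f x - f 0#) - f 0#
          ≈⟨ solve 3 (λ a fx f0 → f0 :+ a :* (fx :- f0) :- f0 := a :* (fx :- f0))
                                                 refl a (f x) (f 0#) ⟩
        a * (f x - f 0#)                    ∎

  -- Affinity gives equality

  module Affine (f-affine : IsFqAffine f) where

    g : Carrier → Carrier
    g x = f x - f 0#

    g-cong : Congruent _≈_ _≈_ g
    g-cong x≈y = +-congʳ (f-cong x≈y)

    g-Fq : ∀ x → InFq (g x)
    g-Fq x = Fq-- (f-Fq x) (f-Fq 0#)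

    open LinearMap g-cong f-affine

    -- z = x + γ f x is solved by g x = g (z - γ f 0) / (1 + g γ).
    permutation : ∀ γ → ¬ 1# + g γ ≈ 0# → P H γ
    permutation γ d≉0 = injective , λ z → G z , λ {x} x≈Gz → trans (F-cong x≈Gz) (F-G z)
      where
      d = 1# + g γ
      e = inv d
      e∈ : InFq e
      e∈ = Fq-inv (inv-inverse d≉0) (Fq-+ Fq-1 (g-Fq γ))

      F G w : Carrier → Carrier
      F x = x + γ * f x
      w z = z - γ * f 0#
      G z = w z - γ * (e * g (w z))

      F-cong : Congruent _≈_ _≈_ F
      F-cong x≈y = +-cong x≈y (*-congˡ (f-cong x≈y))

      G-cong : Congruent _≈_ _≈_ G
      G-cong x≈y = +-cong (+-congʳ x≈y) (-‿cong (*-congˡ (*-congˡ (g-cong (+-congʳ x≈y)))))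

      g-G : ∀ z → g (G z) ≈ e * g (w z)
      g-G z = begin
        g (w z - γ * (e * g (w z)))          ≈⟨ g-- _ _ ⟩
        g (w z) - g (γ * (e * g (w z)))
          ≈⟨ +-cong (sym (*-identityˡ _)) (-‿cong (g-*ʳ γ (Fq-* e∈ (g-Fq (w z))))) ⟩
        1# * g (w z) - e * g (w z) * g γ     ≈⟨ +-congʳ (*-congʳ (inv-inverse d≉0)) ⟨
        e * d * g (w z) - e * g (w z) * g γ
          ≈⟨ solve 3 (λ e y v → e :* (con (+ 1) :+ v) :* y :- e :* y :* v := e :* y) refl e (g (w z)) (g γ) ⟩
        e * g (w z)                          ∎

      F-G : ∀ z → F (G z) ≈ z
      F-G z = begin
        G z + γ * f (G z)
          ≈⟨ solve 4 (λ x γ fx f0 → x :+ γ :* fx := x :+ γ :* (fx :- f0) :+ γ :* f0) refl (G z) γ (f (G z)) (f 0#) ⟩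
        G z + γ * g (G z) + γ * f 0#                       ≈⟨ +-congʳ (+-congˡ (*-congˡ (g-G z))) ⟩
        G z + γ * (e * g (w z)) + γ * f 0#
          ≈⟨ solve 4 (λ z γ f0 t → ((z :- γ :* f0) :- γ :* t) :+ γ :* t :+ γ :* f0 := z)
                                                                refl z γ (f 0#) (e * g (w z)) ⟩
        z                                                  ∎

      w-F : ∀ x → w (F x) ≈ x + γ * g x
      w-F x = solve 4 (λ x γ fx f0 → (x :+ γ :* fx) :- γ :* f0 := x :+ γ :* (fx :- f0)) refl x γ (f x) (f 0#)

      G-F : ∀ x → G (F x) ≈ x
      G-F x = begin
        w (F x) - γ * (e * g (w (F x)))    ≈⟨ +-cong (w-F x) (-‿cong (*-congˡ (begin
          e * g (w (F x))                    ≈⟨ *-congˡ (g-cong (w-F x)) ⟩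
          e * g (x + γ * g x)                ≈⟨ *-congˡ (trans (g-+ _ _) (+-congˡ (g-*ʳ γ (g-Fq x)))) ⟩
          e * (g x + g x * g γ)
            ≈⟨ solve 3 (λ e y v → e :* (y :+ y :* v) := e :* (con (+ 1) :+ v) :* y) refl e (g x) (g γ) ⟩
          e * d * g x                        ≈⟨ *-congʳ (inv-inverse d≉0) ⟩
          1# * g x                           ≈⟨ *-identityˡ _ ⟩
          g x                                ∎))) ⟩
        (x + γ * g x) - γ * g x            ≈⟨ solve 2 (λ x t → (x :+ t) :- t := x) refl x (γ * g x) ⟩
        x                                  ∎

      injective : ∀ {x y} → F x ≈ F y → x ≈ y
      injective {x} {y} Fx≈Fy = trans (sym (G-F x)) (trans (G-cong Fx≈Fy) (G-F y))

    bad-value-eq : ∀ {γ} → Bad γ → g γ ≈ - 1#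
    bad-value-eq {γ} bad with 1# + g γ ≟ 0#
    ... | no  d≉0 = contradiction (permutation γ d≉0) bad
    ... | yes d≈0 = begin
      g γ                ≈⟨ solve 1 (λ v → v := (con (+ 1) :+ v) :- con (+ 1)) refl (g γ) ⟩
      (1# + g γ) - 1#    ≈⟨ +-congʳ d≈0 ⟩
      0# - 1#            ≈⟨ +-identityˡ _ ⟩
      - 1#               ∎

    -- A nonzero value of `g` lies in F_q together with its inverse, so linearity rescales it to 1.
    -- Multiples of this u shift `g` by any prescribed element of F_q.
    unit : ∃ λ u → g u ≈ 1#
    unit with f-varies (f 0#)
    ... | v , fv≉f0 = inv (g v) * v , trans (g-* (inv (g v)) v (Fq-inv gv-inverse (g-Fq v))) gv-inverse
      where
      gv-inverse : inv (g v) * g v ≈ 1#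
      gv-inverse = inv-inverse (-‿≉0 fv≉f0)

    -- Translation by u (a + 1) raises `g` by a + 1, the distance from -1 to a.
    fibre-translate : ∀ a → InFq a → fibre g (- 1#) ℕ.≤ fibre g a
    fibre-translate a a∈ = count-transport (λ x → g x ≟ - 1#) (λ x → g x ≟ a)
      (λ x≈y gx≈a → trans (g-cong (sym x≈y)) gx≈a) (translation (u * (a + 1#))) λ {x} gx≈-1 → begin
        g (x + u * (a + 1#))        ≈⟨ g-+ _ _ ⟩
        g x + g (u * (a + 1#))      ≈⟨ +-cong gx≈-1 (trans (g-*ʳ u (Fq-+ a∈ Fq-1)) (*-congˡ gu≈1)) ⟩
        - 1# + (a + 1#) * 1#
          ≈⟨ solve 1 (λ a → :- con (+ 1) :+ (a :+ con (+ 1)) :* con (+ 1) := a) refl a ⟩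
        a                           ∎
      where
      u = proj₁ unit
      gu≈1 = proj₂ unit

    -- The fibre over -1 contains the bad values, and `q` disjoint fibres at least as large fit into
    -- q * q ^ m elements.
    #Bad≤q^m : #Bad ℕ.≤ q ℕ.^ m
    #Bad≤q^m = ℕ.≤-trans (count-mono (Bad?) (λ x → g x ≟ - 1#) bad-value-eq)
      (ℕ.*-cancelˡ-≤ q (≡.subst (λ s → s ℕ.* fibre g (- 1#) ℕ.≤ N) #Fq≡q (fibres-lower g fibre-translate)))

-- From bad values to the permutation count

theorem2p8 : ∀ {c ℓ₁ ℓ₂} (q n : ℕ) → IsPrimePower q → 1 ≤ n →
    (K : HeytingField c ℓ₁ ℓ₂)
    (enum : HasSize K (q ^ n)) →
    let open FiniteField q n K enum in
    (H : Polynomial) → ¬ IsConstant (TrOf H) →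
    (∣P∣ H ≤ q ^ n ∸ q ^ (n ∸ 1))
    × ((∣P∣ H ≡ q ^ n ∸ q ^ (n ∸ 1)) ⇔ IsFqAffine (TrOf H))
    × (TrOf H 0# ≈ 0# → (∣P∣ H ≡ q ^ n ∸ q ^ (n ∸ 1)) ⇔ IsFqLinear (TrOf H))
    × (IsFqLinear (TrOf H) ⇔ (∃ λ u → ∀ x → TrOf H x ≈ Tr (u * x)))
theorem2p8 q (suc m) q-primePower _ K enum H nonconstant =
    bound
  , affine⇔
  , (λ f0≈0 → mk⇔ (λ max → linear-cong (offset f0≈0) (Equivalence.to affine⇔ max))
                  (λ linear → Equivalence.from affine⇔ (linear-cong (sym ∘ offset f0≈0) linear)))
  , mk⇔ (Duality.representation f-cong f-Fq)
        (λ (u , f≈) → linear-cong (sym ∘ f≈) (trace-linear u))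
  where
  open Directions q m q-primePower K enum H nonconstant

  ∣P∣≡ : ∣P∣ H ≡ N ∸ #Bad
  ∣P∣≡ = ≡.trans (≡.sym (ℕ.m+n∸n≡m (∣P∣ H) (#Bad))) (≡.cong (_∸ #Bad) (#P+#Bad))

  bound : ∣P∣ H ≤ N ∸ q ^ m
  bound = ℕ.≤-trans (ℕ.≤-reflexive ∣P∣≡) (ℕ.∸-monoʳ-≤ N (q^m≤#Bad))

  #Bad≤N : #Bad ≤ N
  #Bad≤N = ≡.subst (#Bad ≤_) (#P+#Bad) (ℕ.m≤n+m _ (∣P∣ H))

  affine⇔ : (∣P∣ H ≡ N ∸ q ^ m) ⇔ IsFqAffine (TrOf H)
  affine⇔ = mk⇔
    -- Subtraction is truncated: cancelling `N` requires that both `#Bad` and q ^ m are at most `N`.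
    (λ max → Tight.affine (ℕ.∸-cancelˡ-≡ #Bad≤N
      (ℕ.≤-trans (q^m≤#Bad) #Bad≤N) (≡.trans (≡.sym ∣P∣≡) max)))
    (λ affine → ≡.trans ∣P∣≡ (≡.cong (N ∸_)
      (ℕ.≤-antisym (Affine.#Bad≤q^m affine) (q^m≤#Bad))))

  offset : TrOf H 0# ≈ 0# → ∀ x → TrOf H x - TrOf H 0# ≈ TrOf H x
  offset f0≈0 x = trans (+-congˡ (trans (-‿cong f0≈0) -0#≈0#)) (+-identityʳ _)

  trace-linear : ∀ u → IsFqLinear (λ x → Tr (u * x))
  trace-linear u =
      (λ x y → trans (Tr-cong (distribˡ u x y)) (Tr-+ (u * x) (u * y)))
    , (λ a x a∈ → trans (Tr-cong (solve 3 (λ u a x → u :* (a :* x) := a :* (u :* x)) refl u a x)) (Tr-* a (u * x) a∈))
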